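{- Let $G$ be a graph on $n$ vertices, let $h,k$ be integers with $1\le h\le k\le\frac n2$, let $B$ be the $(n;k,h)$-binomial matrix, and let $L_h$ and $L_k$ be the Laplacian matrices of the token graphs $F_h(G)$ and $F_k(G)$. Then: (i) If $v$ is a $\lambda$-eigenvector of $L_h$, then $Bv$ is a $\lambda$-eigenvector of $L_k$. Moreover, linear independence of eigenvectors is preserved: if $v_1,\dots,v_r$ are linearly independent eigenvectors of $L_h$, then $Bv_1,\dots,Bv_r$ are linearly independent. (That is, the spectrum of $L_h$ is contained, with multiplicities, in the spectrum of $L_k$.) (ii) If $w$ is a $\lambda$-eigenvector of $L_k$ and $B^{\top}w\neq 0$, then $B^{\top}w$ is a $\lambda$-eigenvector of $L_h$. Moreover, all the eigenvalues of $L_h$, including multiplicities, are obtained in this way: for every eigenvalue $\lambda$ of $L_h$ of multiplicity $m$, there are $m$ $\lambda$-eigenvectors $w_1,\dots,w_m$ of $L_k$ such that $B^{\top}w_1,\dots,B^{\top}w_m$ are linearly independent.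
   Context: All graphs are finite and simple. For a graph $G$ with vertex set $[n]=\{1,\dots,n\}$ and $1\le k\le n$, the $k$-token graph $F_k(G)$ has as vertices the $k$-subsets of $[n]$; two vertices $A,B$ are adjacent iff $A\bigtriangleup B=\{a,b\}$ with $a\in A$, $b\in B$ and $\{a,b\}$ an edge of $G$. The Laplacian matrix of a graph is the diagonal degree matrix minus the adjacency matrix. The $(n;k,h)$-binomial matrix $B$ is the $\binom nk\times\binom nh$ $(0,1)$-matrix with rows indexed by the $k$-subsets $A\subseteq[n]$ and columns indexed by the $h$-subsets $X\subseteq[n]$, with $B_{AX}=1$ if $X\subseteq A$ and $B_{AX}=0$ otherwise. A $\lambda$-eigenvector is a nonzero eigenvector with eigenvalue $\lambda$. The same orderings of subsets are used for $B$, $L_h$, $L_k$. -}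

module Defs where

open import Algebra.Apartness.Bundles using (HeytingField; HeytingCommutativeRing)
open import Algebra.Bundles using (CommutativeRing)
import Algebra.Definitions.RawMonoid as RawMonoidDefinitions
open import Data.Bool using (if_then_else_)
import Data.Bool.Properties as Bool
open import Data.Fin using (Fin)
open import Data.Fin.Properties using (any?)
open import Data.Fin.Subset
  using (Subset; inside; outside; ∣_∣; _∈_; _∪_; _─_; ⁅_⁆)
open import Data.Fin.Subset.Properties
  using (_∈?_; _⊆?_; ∪-comm; ∪-idem; x∈⁅x⁆; x∈p∪q⁺)
open import Data.List using (List; []; _∷_; _++_; map; filter; length; lookup)
import Data.List.Membership.Propositional as List
open import Data.List.Membership.Propositional.Properties using (∈-map⁺; ∈-map⁻; ∈-++⁺ˡ; ∈-++⁺ʳ)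
open import Data.List.Relation.Unary.All using ([])
open import Data.List.Relation.Unary.AllPairs using ([]; _∷_)
open import Data.List.Relation.Unary.Any using (here)
open import Data.List.Relation.Unary.Unique.Propositional using (Unique)
import Data.List.Relation.Unary.Unique.Propositional.Properties as Unique
open import Data.Nat using (ℕ; zero; suc) renaming (_≤_ to _≤ℕ_)
import Data.Nat.Properties as ℕ
open import Data.Product using (Σ; ∃; ∃-syntax; _×_; _,_; proj₁; proj₂)
open import Data.Sum using (_⊎_; inj₁; inj₂)
open import Data.Vec using ([]; _∷_; here; there)
import Data.Vec.Properties as Vec
open import Function using (_⇔_)
open import Level using (Level; 0ℓ; _⊔_) renaming (suc to lsuc)
open import Relation.Binary
  using (Rel; Decidable; DecidableEquality; Symmetric; Irreflexive; IsStrictPartialOrder)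
open import Relation.Binary.PropositionalEquality
  using (_≡_; _≢_; refl; sym; trans; cong; subst)
open import Relation.Nullary using (¬_; does)
open import Relation.Nullary.Decidable using (_×-dec_; map′)

-- The real numbers, given axiomatically: a Cauchy-complete Archimedean
-- ordered field.  Classically these axioms determine ℝ up to
-- isomorphism.  They are phrased with an apartness relation so that they
-- also hold of constructively defined reals, for which the order and the
-- equality are not decidable.

record RealNumbers c ℓ₁ ℓ₂ ℓ₃ : Set (lsuc (c ⊔ ℓ₁ ⊔ ℓ₂ ⊔ ℓ₃)) where
  infix 4 _<_
  field
    heytingField : HeytingField c ℓ₁ ℓ₂

  open HeytingField heytingField public

  open RawMonoidDefinitions
    (CommutativeRing.+-rawMonoid
      (HeytingCommutativeRing.commutativeRing heytingCommutativeRing)) public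
    using (sum) renaming (_×_ to _·_)

  field
    _<_                  : Rel Carrier ℓ₃
    isStrictPartialOrder : IsStrictPartialOrder _≈_ _<_
    #⇔<⊎>                : ∀ x y → (x # y) ⇔ (x < y ⊎ y < x)
    +-monoˡ-<            : ∀ z {x y} → x < y → x + z < y + z
    *-pos                : ∀ {x y} → 0# < x → 0# < y → 0# < x * y
    archimedean          : ∀ x → ∃[ n ] x < n · 1#
    complete             : ∀ (u : ℕ → Carrier) →
      (∀ ε → 0# < ε → ∃[ N ] ∀ i j → N ≤ℕ i → N ≤ℕ j → u i < u j + ε) →
      ∃[ l ] ∀ ε → 0# < ε → ∃[ N ] ∀ i → N ≤ℕ i → (u i < l + ε) × (l < u i + ε)

-- Coordinates, rows and columns are indexed directly by the elements of
-- finite sets; the list only serves to sum over such a set.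

record Finite (A : Set) : Set where
  field
    elements    : List A
    exhaustive  : ∀ a → a List.∈ elements
    unique      : Unique elements
    _≟_         : DecidableEquality A

open Finite {{...}} public

record SimpleGraph (V : Set) : Set₁ where
  field
    Adjacent  : Rel V 0ℓ
    adjacent? : Decidable Adjacent
    symmetric : Symmetric Adjacent
    loopless  : Irreflexive _≡_ Adjacent

open SimpleGraph public

degree : ∀ {V : Set} {{_ : Finite V}} → SimpleGraph V → V → ℕ
degree G a = length (filter (adjacent? G a) elements)

-- The proof component of a k-subset is unique, so
-- elements are equal exactly when the underlying subsets are.

KSubset : ℕ → ℕ → Set
KSubset n k = Σ (Subset n) λ A → ∣ A ∣ ≡ k

KSubset-≡ : ∀ {n k} {A B : KSubset n k} → proj₁ A ≡ proj₁ B → A ≡ B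
KSubset-≡ {A = A , p} {B = .A , q} refl = cong (A ,_) (ℕ.≡-irrelevant p q)

private
  variable
    n k : ℕ

  exclude : KSubset n k → KSubset (suc n) k
  exclude (A , p) = outside ∷ A , p

  include : KSubset n k → KSubset (suc n) (suc k)
  include (A , p) = inside ∷ A , cong suc p

  exclude-injective : {A B : KSubset n k} → exclude A ≡ exclude B → A ≡ B
  exclude-injective eq = KSubset-≡ (Vec.∷-injectiveʳ (cong proj₁ eq))

  include-injective : {A B : KSubset n k} → include A ≡ include B → A ≡ B
  include-injective eq = KSubset-≡ (Vec.∷-injectiveʳ (cong proj₁ eq))

  include≢exclude : {A : KSubset n k} {B : KSubset n (suc k)} → include A ≢ exclude B
  include≢exclude eq with Vec.∷-injectiveˡ (cong proj₁ eq)
  ... | ()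

kSubsets : ∀ n k → List (KSubset n k)
kSubsets zero    zero    = ([] , refl) ∷ []
kSubsets zero    (suc k) = []
kSubsets (suc n) zero    = map exclude (kSubsets n zero)
kSubsets (suc n) (suc k) = map include (kSubsets n k) ++ map exclude (kSubsets n (suc k))

kSubsets-exhaustive : ∀ n k (A : KSubset n k) → A List.∈ kSubsets n k
kSubsets-exhaustive zero    zero    ([] , refl) = here refl
kSubsets-exhaustive (suc n) zero    (outside ∷ A , p) =
  ∈-map⁺ exclude (kSubsets-exhaustive n zero (A , p))
kSubsets-exhaustive (suc n) (suc k) (outside ∷ A , p) =
  ∈-++⁺ʳ (map include (kSubsets n k)) (∈-map⁺ exclude (kSubsets-exhaustive n (suc k) (A , p)))
kSubsets-exhaustive (suc n) (suc k) (inside ∷ A , p) =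
  subst (List._∈ kSubsets (suc n) (suc k)) (KSubset-≡ refl)
    (∈-++⁺ˡ (∈-map⁺ include (kSubsets-exhaustive n k (A , ℕ.suc-injective p))))

kSubsets-unique : ∀ n k → Unique (kSubsets n k)
kSubsets-unique zero    zero    = [] ∷ []
kSubsets-unique zero    (suc k) = []
kSubsets-unique (suc n) zero    = Unique.map⁺ exclude-injective (kSubsets-unique n zero)
kSubsets-unique (suc n) (suc k) = Unique.++⁺
  (Unique.map⁺ include-injective (kSubsets-unique n k))
  (Unique.map⁺ exclude-injective (kSubsets-unique n (suc k)))
  λ (p , q) → disjoint (∈-map⁻ include p) (∈-map⁻ exclude q)
  where
  disjoint : ∀ {C : KSubset (suc n) (suc k)} →
             (∃[ A ] A List.∈ kSubsets n k × C ≡ include A) →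
             ¬ (∃[ B ] B List.∈ kSubsets n (suc k) × C ≡ exclude B)
  disjoint (A , _ , p) (B , _ , q) = include≢exclude (trans (sym p) q)

_≟ˢ_ : ∀ {n} → DecidableEquality (Subset n)
_≟ˢ_ = Vec.≡-dec Bool._≟_

instance
  KSubset-finite : ∀ {n k} → Finite (KSubset n k)
  KSubset-finite {n} {k} = record
    { elements   = kSubsets n k
    ; exhaustive = kSubsets-exhaustive n k
    ; unique     = kSubsets-unique n k
    ; _≟_        = λ A B → map′ KSubset-≡ (cong proj₁) (proj₁ A ≟ˢ proj₁ B)
    }

_△_ : ∀ {n} → Subset n → Subset n → Subset n
A △ B = (A ─ B) ∪ (B ─ A)

△-comm : ∀ {n} (A B : Subset n) → A △ B ≡ B △ A
△-comm A B = ∪-comm (A ─ B) (B ─ A)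

private
  x∉p─p : ∀ {n} (p : Subset n) {x} → ¬ (x ∈ p ─ p)
  x∉p─p (inside  ∷ p) (there x∈) = x∉p─p p x∈
  x∉p─p (outside ∷ p) (there x∈) = x∉p─p p x∈

TokenAdjacent : ∀ {n} → SimpleGraph (Fin n) → Rel (Subset n) 0ℓ
TokenAdjacent G A B =
  ∃[ a ] ∃[ b ] a ∈ A × b ∈ B × A △ B ≡ ⁅ a ⁆ ∪ ⁅ b ⁆ × Adjacent G a b

tokenGraph : ∀ {n} → SimpleGraph (Fin n) → (k : ℕ) → SimpleGraph (KSubset n k)
tokenGraph G k = record
  { Adjacent  = λ (A , _) (B , _) → TokenAdjacent G A B
  ; adjacent? = λ (A , _) (B , _) → any? λ a → any? λ b →
      (a ∈? A) ×-dec (b ∈? B) ×-dec ((A △ B) ≟ˢ (⁅ a ⁆ ∪ ⁅ b ⁆)) ×-dec adjacent? G a b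
  ; symmetric = λ {(A , _)} {(B , _)} (a , b , a∈A , b∈B , eq , ab) →
      b , a , b∈B , a∈A ,
      trans (△-comm B A) (trans eq (∪-comm ⁅ a ⁆ ⁅ b ⁆)) , symmetric G ab
  ; loopless  = λ { {(A , _)} refl (a , b , _ , _ , eq , _) →
      x∉p─p A (subst (a ∈_) (trans (sym eq) (∪-idem (A ─ A))) (x∈p∪q⁺ (inj₁ (x∈⁅x⁆ a)))) }
  }

module LinearAlgebra {c ℓ₁ ℓ₂ ℓ₃} (ℝ : RealNumbers c ℓ₁ ℓ₂ ℓ₃) where

  open RealNumbers ℝ using (Carrier; _≈_; _+_; _*_; _-_; 0#; 1#; sum; _·_)

  private
    variable
      I J : Set

  Vector : Set → Set c
  Vector I = I → Carrier

  Matrix : Set → Set → Set c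
  Matrix I J = I → J → Carrier

  infixl 7 _*ᵥ_ _*ₛ_
  infix  8 _ᵀ
  infix  4 _≋_

  _≋_ : Vector I → Vector I → Set ℓ₁
  v ≋ w = ∀ a → v a ≈ w a

  0ᵥ : Vector I
  0ᵥ _ = 0#

  _*ₛ_ : Carrier → Vector I → Vector I
  (x *ₛ v) a = x * v a

  sumOver : {{_ : Finite I}} → Vector I → Carrier
  sumOver v = sum (λ i → v (lookup elements i))

  _*ᵥ_ : {{_ : Finite J}} → Matrix I J → Vector J → Vector I
  (M *ᵥ v) a = sumOver (λ b → M a b * v b)

  _ᵀ : Matrix I J → Matrix J I
  (M ᵀ) b a = M a b

  linearCombination : ∀ {r} → (Fin r → Carrier) → (Fin r → Vector I) → Vector I
  linearCombination c v a = sum (λ i → c i * v i a)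

  LinearlyIndependent : ∀ {r} → (Fin r → Vector I) → Set (c ⊔ ℓ₁)
  LinearlyIndependent v = ∀ c → linearCombination c v ≋ 0ᵥ → ∀ i → c i ≈ 0#

  module _ {{_ : Finite I}} (M : Matrix I I) where

    IsEigenvector : Carrier → Vector I → Set ℓ₁
    IsEigenvector μ v = ¬ (v ≋ 0ᵥ) × M *ᵥ v ≋ μ *ₛ v

    IsEigenvalue : Carrier → Set (c ⊔ ℓ₁)
    IsEigenvalue μ = ∃[ v ] IsEigenvector μ v

    -- The multiplicity of μ is the dimension of its eigenspace.  For the
    -- symmetric matrices considered here the algebraic and geometric
    -- multiplicities coincide.
    record HasMultiplicity (μ : Carrier) (m : ℕ) : Set (c ⊔ ℓ₁) where
      field
        basis       : Fin m → Vector I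
        eigen       : ∀ i → M *ᵥ basis i ≋ μ *ₛ basis i
        independent : LinearlyIndependent basis
        spanning    : ∀ v → M *ᵥ v ≋ μ *ₛ v → ∃[ c ] v ≋ linearCombination c basis

  -- Containment of spectra as multisets, expressed through multiplicities.
  SpectrumContained : {{_ : Finite I}} {{_ : Finite J}} →
                      Matrix I I → Matrix J J → Set (c ⊔ ℓ₁)
  SpectrumContained M N =
    (∀ μ → IsEigenvalue M μ → IsEigenvalue N μ) ×
    (∀ μ m m′ → HasMultiplicity M μ m → HasMultiplicity N μ m′ → m ≤ℕ m′)

  degreeMatrix : {{_ : Finite I}} → SimpleGraph I → Matrix I I
  degreeMatrix G a b = if does (a ≟ b) then degree G a · 1# else 0#

  adjacencyMatrix : SimpleGraph I → Matrix I I
  adjacencyMatrix G a b = if does (adjacent? G a b) then 1# else 0#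

  laplacian : {{_ : Finite I}} → SimpleGraph I → Matrix I I
  laplacian G a b = degreeMatrix G a b - adjacencyMatrix G a b

  binomialMatrix : ∀ n k h → Matrix (KSubset n k) (KSubset n h)
  binomialMatrix n k h (A , _) (X , _) = if does (X ⊆? A) then 1# else 0#

{-# OPTIONS --safe #-}

-- A transposition τ of [n] acts on the k-subsets for every k, and
-- 2 Lₖ = Σ (I − τ) over the transpositions τ of all ordered edges of G.
-- Inclusion of subsets is invariant under permutations of [n], so B and Bᵀ
-- intertwine Lₕ and Lₖ.  B is injective for h ≤ k ≤ n − h: split
-- v = (v₀ , v₁) by whether a subset contains a chosen element of [n].  The
-- inductive hypothesis applies to v₀ and then to v₁ unless k is extremal; in
-- that case use that if the sums of v over the h-subsets of A vanish for all
-- A of size k, they do so for all A of size k + 1.  Since ℝ is ordered,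
-- ker (Bᵀ B) = ker B, so the vectors B v realise (ii).

module Submission where

open import Defs
open import Algebra.Apartness.Bundles using (HeytingCommutativeRing)
import Algebra.Apartness.Properties.HeytingCommutativeRing
open import Algebra.Bundles using (CommutativeRing)
import Algebra.Properties.CommutativeMonoid.Mult
import Algebra.Properties.CommutativeMonoid.Sum
import Algebra.Properties.Monoid.Mult
import Algebra.Properties.Ring
import Algebra.Properties.Semiring.Mult
import Algebra.Properties.Semiring.Sum
import Algebra.Solver.Ring.NaturalCoefficients.Default
open import Data.Bool using (Bool; true; false; not; _∧_; if_then_else_)
open import Data.Fin using (Fin; zero; suc; punchIn) renaming (_≟_ to _≟ᶠ_)
open import Data.Fin.Permutation using (Permutation′; flip; inverseʳ; _⟨$⟩ʳ_; _⟨$⟩ˡ_)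
  renaming (transpose to transposition)
open import Data.Fin.Permutation.Components using (transpose)
open import Data.Fin.Subset using (Subset; inside; outside; ∣_∣; _∈_; _∉_; _⊆_; _∪_; _─_; ⁅_⁆)
open import Data.Fin.Subset.Properties
  using (_∈?_; _⊆?_; x∈⁅x⁆; x∈⁅y⁆⇒x≡y; ⊆-antisym; x∈p∪q⁻; x∈p∪q⁺)
open import Data.List using (List; []; _∷_; map; _++_; filter; length) renaming (lookup to lookupᴸ)
import Data.List.Membership.Propositional as List
open import Data.List.Relation.Unary.All using (All)
import Data.List.Relation.Unary.All as All
open import Data.List.Relation.Unary.AllPairs using ([]; _∷_)
open import Data.List.Relation.Unary.Any using (here; there; index)
open import Data.List.Relation.Unary.Any.Properties using (lookup-index)
open import Data.List.Relation.Unary.Unique.Propositional using (Unique)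
open import Data.Nat as ℕ using (ℕ; zero; suc; _≤_; z≤n; s≤s; s≤s⁻¹)
import Data.Nat.Properties as ℕ
open import Data.Product using (∃; ∃-syntax; _×_; _,_; proj₁; proj₂)
open import Data.Sum using (_⊎_; inj₁; inj₂)
open import Data.Vec using ([]; _∷_; here; there; lookup; tabulate)
open import Data.Vec.Functional using (insertAt)
open import Data.Vec.Functional.Properties using (insertAt-lookup; insertAt-punchIn)
open import Data.Vec.Properties
  using (lookup∘tabulate; tabulate∘lookup; tabulate-cong; lookup⇒[]=; []=⇒lookup)
open import Function using (_∘_; Equivalence)
open import Level using (_⊔_)
open import Relation.Binary using (IsStrictPartialOrder)
open import Relation.Binary.PropositionalEquality as ≡ using (_≡_; _≢_)
import Relation.Binary.Reasoning.Setoid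
open import Relation.Nullary using (¬_; Dec; yes; no; does; contradiction)
open import Relation.Nullary.Decidable
  using (dec-true; dec-false; ¬?; _×-dec_; does-≡; map′; ¬¬-excluded-middle; decidable-stable)
open import Relation.Unary using (Pred; Decidable)

open Algebra.Properties.CommutativeMonoid.Sum ℕ.+-0-commutativeMonoid
  using () renaming (sum to sumℕ; sum-permute to sumℕ-permute; sum-cong-≗ to sumℕ-cong)

-- `RealNumbers` decides neither equality nor order. Case distinctions on whether a real is apart
-- from zero are therefore made under double negation, and the conclusions are chosen to be stable:
-- `x ≈ 0#` by tightness, inequalities of naturals by decidability.
--
-- The sum of I - τ may run over all ordered edges, whatever the subset acted on: a transposition
-- with both or neither of its points in `A` fixes `A` and contributes nothing. Its coefficients are
-- then entries of the adjacency matrix of `G`, the same for every `k`, so a matrix invariant under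
-- transpositions intertwines the Laplacians. Characteristic zero cancels the factor 2.
--
-- Injectivity is proved under `h + k ≤ n` because the step for v₀ can keep `h` and `k` while `n`
-- drops, which `2 * k ≤ n` would not survive.

private
  variable
    h k m n r : ℕ
    I J : Set

-- Permutations acting on subsets

transpose-left : (a b : Fin n) → transpose a b a ≡ b
transpose-left a b rewrite dec-true (a ≟ᶠ a) ≡.refl = ≡.refl

transpose-right : (a b : Fin n) → transpose a b b ≡ a
transpose-right a b with b ≟ᶠ a
... | yes b≡a = b≡a
... | no  _   rewrite dec-true (b ≟ᶠ b) ≡.refl = ≡.refl

transpose-other : ∀ {a b i : Fin n} → i ≢ a → i ≢ b → transpose a b i ≡ i
transpose-other {a = a} {b} {i} i≢a i≢b
  rewrite dec-false (i ≟ᶠ a) i≢a | dec-false (i ≟ᶠ b) i≢b = ≡.refl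

-- The motive `P` relates an index to its image, so equalities between permuted subsets reduce to
-- three cases: the two moved points and a fixed one.
transpose-cases : ∀ {p} (P : Fin n → Fin n → Set p) (a b : Fin n) →
                  P a b → P b a → (∀ i → i ≢ a → i ≢ b → P i i) →
                  ∀ i → P i (transpose a b i)
transpose-cases P a b Pab Pba Pii i = cases (i ≟ᶠ a) (i ≟ᶠ b)
  where
  cases : Dec (i ≡ a) → Dec (i ≡ b) → P i (transpose a b i)
  cases (yes ≡.refl) _            = ≡.subst (P a) (≡.sym (transpose-left a b)) Pab
  cases (no _)       (yes ≡.refl) = ≡.subst (P b) (≡.sym (transpose-right a b)) Pba
  cases (no i≢a)     (no i≢b)     = ≡.subst (P i) (≡.sym (transpose-other i≢a i≢b)) (Pii i i≢a i≢b)

subset-ext : {A B : Subset n} → (∀ i → lookup A i ≡ lookup B i) → A ≡ B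
subset-ext {A = A} {B} eq =
  ≡.trans (≡.sym (tabulate∘lookup A)) (≡.trans (tabulate-cong eq) (tabulate∘lookup B))

-- As a set this is the preimage of `A` under `π`, so `flip π` undoes it; for a transposition it is
-- also the image.
permute : Permutation′ n → Subset n → Subset n
permute π A = tabulate (λ i → lookup A (π ⟨$⟩ʳ i))

lookup-permute : ∀ (π : Permutation′ n) A i → lookup (permute π A) i ≡ lookup A (π ⟨$⟩ʳ i)
lookup-permute π A = lookup∘tabulate _

bit : Bool → ℕ
bit false = 0
bit true  = 1

∣∣≡sum : (A : Subset n) → ∣ A ∣ ≡ sumℕ (λ i → bit (lookup A i))
∣∣≡sum []          = ≡.refl
∣∣≡sum (false ∷ A) = ∣∣≡sum A
∣∣≡sum (true  ∷ A) = ≡.cong suc (∣∣≡sum A)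

∣permute∣ : ∀ (π : Permutation′ n) A → ∣ permute π A ∣ ≡ ∣ A ∣
∣permute∣ π A = begin
  ∣ permute π A ∣                             ≡⟨ ∣∣≡sum (permute π A) ⟩
  sumℕ (λ i → bit (lookup (permute π A) i))   ≡⟨ sumℕ-cong (λ i → ≡.cong bit (lookup-permute π A i)) ⟩
  sumℕ (λ i → bit (lookup A (π ⟨$⟩ʳ i)))      ≡⟨ sumℕ-permute (λ i → bit (lookup A i)) π ⟨
  sumℕ (λ i → bit (lookup A i))               ≡⟨ ∣∣≡sum A ⟨
  ∣ A ∣                                       ∎
  where open ≡.≡-Reasoning

permute-flip : ∀ (π : Permutation′ n) A → permute (flip π) (permute π A) ≡ A
permute-flip π A = subset-ext λ i →
  ≡.trans (lookup-permute (flip π) (permute π A) i)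
    (≡.trans (lookup-permute π A (π ⟨$⟩ˡ i)) (≡.cong (lookup A) (inverseʳ π)))

∈-permute⁺ : ∀ (π : Permutation′ n) {A i} → π ⟨$⟩ʳ i ∈ A → i ∈ permute π A
∈-permute⁺ π {A} {i} πi∈A = lookup⇒[]= i _ (≡.trans (lookup-permute π A i) ([]=⇒lookup πi∈A))

∈-permute⁻ : ∀ (π : Permutation′ n) {A i} → i ∈ permute π A → π ⟨$⟩ʳ i ∈ A
∈-permute⁻ π {A} {i} i∈πA = lookup⇒[]= (π ⟨$⟩ʳ i) A (≡.trans (≡.sym (lookup-permute π A i)) ([]=⇒lookup i∈πA))

⊆-permute⁺ : ∀ (π : Permutation′ n) {X A} → X ⊆ A → permute π X ⊆ permute π A
⊆-permute⁺ π {X} {A} X⊆A i∈πX = ∈-permute⁺ π {A} (X⊆A (∈-permute⁻ π {X} i∈πX))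

⊆-permute⁻ : ∀ (π : Permutation′ n) {X A} → permute π X ⊆ permute π A → X ⊆ A
⊆-permute⁻ π {X} {A} πX⊆πA =
  ≡.subst₂ _⊆_ (permute-flip π X) (permute-flip π A)
    (⊆-permute⁺ (flip π) {permute π X} {permute π A} πX⊆πA)

permuteK : Permutation′ n → KSubset n k → KSubset n k
permuteK π (A , ∣A∣≡k) = permute π A , ≡.trans (∣permute∣ π A) ∣A∣≡k

permuteK-flip : ∀ (π : Permutation′ n) (A : KSubset n k) → permuteK (flip π) (permuteK π A) ≡ A
permuteK-flip π (A , _) = KSubset-≡ (permute-flip π A)

swap : Fin n → Fin n → KSubset n k → KSubset n k
swap a b = permuteK (transposition a b)

swap-comm : ∀ (a b : Fin n) (A : KSubset n k) → swap a b A ≡ swap b a A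
swap-comm a b (A , _) = KSubset-≡ (tabulate-cong λ i → ≡.cong (lookup A)
  (transpose-cases (λ i j → j ≡ transpose b a i) a b
    (≡.sym (transpose-right b a)) (≡.sym (transpose-left b a))
    (λ i i≢a i≢b → ≡.sym (transpose-other i≢b i≢a)) i))

swap-fix : ∀ (a b : Fin n) (A : KSubset n k) →
           lookup (proj₁ A) a ≡ lookup (proj₁ A) b → swap a b A ≡ A
swap-fix a b (A , _) eq = KSubset-≡ (subset-ext λ i →
  ≡.trans (lookup-permute (transposition a b) A i)
    (transpose-cases (λ i j → lookup A j ≡ lookup A i) a b (≡.sym eq) eq (λ _ _ _ → ≡.refl) i))

-- Symmetric differences, and token moves as transpositions

∉⇒lookup : {A : Subset n} {i : Fin n} → i ∉ A → lookup A i ≡ false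
∉⇒lookup {A = A} {i} i∉A with lookup A i in eq
... | false = ≡.refl
... | true  = contradiction (lookup⇒[]= i A eq) i∉A

lookup⇒∉ : {A : Subset n} {i : Fin n} → lookup A i ≡ false → i ∉ A
lookup⇒∉ eq i∈A with ≡.trans (≡.sym eq) ([]=⇒lookup i∈A)
... | ()

∈─⁺ : {A B : Subset n} {i : Fin n} → i ∈ A → i ∉ B → i ∈ A ─ B
∈─⁺ {A = inside ∷ A} {outside ∷ B} here       i∉B = here
∈─⁺ {A = inside ∷ A} {inside ∷ B}  here       i∉B = contradiction here i∉B
∈─⁺ {A = _ ∷ A}      {_ ∷ B}      (there i∈A) i∉B = there (∈─⁺ i∈A (i∉B ∘ there))

∈─⁻ : {A B : Subset n} {i : Fin n} → i ∈ A ─ B → i ∈ A × i ∉ B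
∈─⁻ {A = inside  ∷ _} {outside ∷ _} {zero} _ = here , λ ()
∈─⁻ {A = outside ∷ _} {inside  ∷ _} {zero} ()
∈─⁻ {A = outside ∷ _} {outside ∷ _} {zero} ()
∈─⁻ {A = _ ∷ A} {_ ∷ B} {suc _} (there i∈) with ∈─⁻ {A = A} {B} i∈
... | i∈A , i∉B = there i∈A , λ { (there i∈B) → i∉B i∈B }

∈△⁻ : {A B : Subset n} {i : Fin n} → i ∈ A △ B → (i ∈ A × i ∉ B) ⊎ (i ∈ B × i ∉ A)
∈△⁻ {A = A} {B} i∈ with x∈p∪q⁻ (A ─ B) (B ─ A) i∈
... | inj₁ p = inj₁ (∈─⁻ {A = A} {B} p)
... | inj₂ p = inj₂ (∈─⁻ {A = B} {A} p)

∈△⁺ : {A B : Subset n} {i : Fin n} → (i ∈ A × i ∉ B) ⊎ (i ∈ B × i ∉ A) → i ∈ A △ B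
∈△⁺ (inj₁ (p , q)) = x∈p∪q⁺ (inj₁ (∈─⁺ p q))
∈△⁺ {A = A} {B} (inj₂ (p , q)) = x∈p∪q⁺ {p = A ─ B} (inj₂ (∈─⁺ p q))

∉△⇒≡ : {A B : Subset n} {i : Fin n} → i ∉ A △ B → lookup A i ≡ lookup B i
∉△⇒≡ {A = A} {B} {i} i∉ with i ∈? A | i ∈? B
... | yes p | yes q = ≡.trans ([]=⇒lookup p) (≡.sym ([]=⇒lookup q))
... | yes p | no  q = contradiction (∈△⁺ (inj₁ (p , q))) i∉
... | no  p | yes q = contradiction (∈△⁺ (inj₂ (q , p))) i∉
... | no  p | no  q = ≡.trans (∉⇒lookup p) (≡.sym (∉⇒lookup q))

≡⇒∉△ : {A B : Subset n} {i : Fin n} → lookup A i ≡ lookup B i → i ∉ A △ B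
≡⇒∉△ {A = A} {B} {i} eq i∈ with ∈△⁻ {A = A} {B} i∈
... | inj₁ (p , q) = q (lookup⇒[]= i B (≡.trans (≡.sym eq) ([]=⇒lookup p)))
... | inj₂ (p , q) = q (lookup⇒[]= i A (≡.trans eq ([]=⇒lookup p)))

∈pair⁻ : {a b i : Fin n} → i ∈ ⁅ a ⁆ ∪ ⁅ b ⁆ → i ≡ a ⊎ i ≡ b
∈pair⁻ {a = a} {b} i∈ with x∈p∪q⁻ ⁅ a ⁆ ⁅ b ⁆ i∈
... | inj₁ p = inj₁ (x∈⁅y⁆⇒x≡y a p)
... | inj₂ p = inj₂ (x∈⁅y⁆⇒x≡y b p)

left∈pair : (a b : Fin n) → a ∈ ⁅ a ⁆ ∪ ⁅ b ⁆
left∈pair a b = x∈p∪q⁺ (inj₁ (x∈⁅x⁆ a))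

right∈pair : (a b : Fin n) → b ∈ ⁅ a ⁆ ∪ ⁅ b ⁆
right∈pair a b = x∈p∪q⁺ {p = ⁅ a ⁆} (inj₂ (x∈⁅x⁆ b))

-- Token adjacency seen from `A` alone: the move determines the target set, and `b ∉ A` takes the
-- place of the conditions on that set.
Movable : SimpleGraph (Fin n) → Subset n → Fin n → Fin n → Set
Movable G A a b = a ∈ A × b ∉ A × Adjacent G a b

movable? : ∀ (G : SimpleGraph (Fin n)) A a b → Dec (Movable G A a b)
movable? G A a b = (a ∈? A) ×-dec ¬? (b ∈? A) ×-dec adjacent? G a b

module _ {A B : Subset n} {a b : Fin n} (a∈A : a ∈ A) where

  -- Both points lie in the symmetric difference, so `a` has left and `b` has entered. Every other
  -- point keeps its status, exactly as under the transposition.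
  △-pair⇒permute : b ∈ B → A △ B ≡ ⁅ a ⁆ ∪ ⁅ b ⁆ → b ∉ A × permute (transposition a b) A ≡ B
  △-pair⇒permute b∈B eq with ∈△⁻ {A = A} {B} (≡.subst (a ∈_) (≡.sym eq) (left∈pair a b))
                           | ∈△⁻ {A = A} {B} (≡.subst (b ∈_) (≡.sym eq) (right∈pair a b))
  ... | inj₂ (_ , a∉A) | _              = contradiction a∈A a∉A
  ... | _              | inj₁ (_ , b∉B) = contradiction b∈B b∉B
  ... | inj₁ (_ , a∉B) | inj₂ (_ , b∉A) = b∉A , subset-ext λ i →
    ≡.trans (lookup-permute (transposition a b) A i)
      (transpose-cases (λ i j → lookup A j ≡ lookup B i) a b
        (≡.trans (∉⇒lookup b∉A) (≡.sym (∉⇒lookup a∉B)))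
        (≡.trans ([]=⇒lookup a∈A) (≡.sym ([]=⇒lookup b∈B)))
        (λ i i≢a i≢b → ∉△⇒≡ λ i∈ → case-pair i≢a i≢b (∈pair⁻ (≡.subst (i ∈_) eq i∈))) i)
    where
    case-pair : ∀ {i} → i ≢ a → i ≢ b → ¬ (i ≡ a ⊎ i ≡ b)
    case-pair i≢a i≢b (inj₁ i≡a) = i≢a i≡a
    case-pair i≢a i≢b (inj₂ i≡b) = i≢b i≡b

left∉permute : ∀ (A : Subset n) {a b} → b ∉ A → a ∉ permute (transposition a b) A
left∉permute A {a} {b} b∉A = lookup⇒∉ (≡.trans (lookup-permute (transposition a b) A a)
  (≡.trans (≡.cong (lookup A) (transpose-left a b)) (∉⇒lookup b∉A)))

right∈permute : ∀ (A : Subset n) {a b} → a ∈ A → b ∈ permute (transposition a b) A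
right∈permute A {a} {b} a∈A = lookup⇒[]= b _ (≡.trans (lookup-permute (transposition a b) A b)
  (≡.trans (≡.cong (lookup A) (transpose-right a b)) ([]=⇒lookup a∈A)))

module _ (A : Subset n) {a b : Fin n} (a∈A : a ∈ A) (b∉A : b ∉ A) where

  private
    A′ = permute (transposition a b) A

  permute-△ : A △ A′ ≡ ⁅ a ⁆ ∪ ⁅ b ⁆
  permute-△ = ⊆-antisym forth back
    where
    forth : A △ A′ ⊆ ⁅ a ⁆ ∪ ⁅ b ⁆
    forth {i} i∈ with i ≟ᶠ a | i ≟ᶠ b
    ... | yes ≡.refl | _        = left∈pair a b
    ... | no _     | yes ≡.refl = right∈pair a b
    ... | no i≢a   | no i≢b   = contradiction i∈ (≡⇒∉△ {A = A} {A′} (≡.sym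
      (≡.trans (lookup-permute (transposition a b) A i) (≡.cong (lookup A) (transpose-other i≢a i≢b)))))
    back : ⁅ a ⁆ ∪ ⁅ b ⁆ ⊆ A △ A′
    back i∈ with ∈pair⁻ {a = a} {b} i∈
    ... | inj₁ ≡.refl = ∈△⁺ (inj₁ (a∈A , left∉permute A b∉A))
    ... | inj₂ ≡.refl = ∈△⁺ (inj₂ (right∈permute A a∈A , b∉A))

  -- The symmetric difference recovers the unordered pair, and membership in `A` recovers its
  -- orientation. Hence each neighbour is reached by one move only.
  move-unique : ∀ {a′ b′} → a′ ∈ A → b′ ∉ A →
                permute (transposition a′ b′) A ≡ A′ → a′ ≡ a × b′ ≡ b
  move-unique {a′} {b′} a′∈A b′∉A eq = left , right
    where
    left : a′ ≡ a
    left with ∈pair⁻ (≡.subst (a′ ∈_) permute-△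
                (∈△⁺ (inj₁ (a′∈A , ≡.subst (a′ ∉_) eq (left∉permute A b′∉A)))))
    ... | inj₁ a′≡a = a′≡a
    ... | inj₂ ≡.refl = contradiction a′∈A b∉A
    right : b′ ≡ b
    right with ∈pair⁻ (≡.subst (b′ ∈_) permute-△
                 (∈△⁺ (inj₂ (≡.subst (b′ ∈_) eq (right∈permute A a′∈A) , b′∉A))))
    ... | inj₁ ≡.refl = contradiction a∈A b′∉A
    ... | inj₂ b′≡b = b′≡b

module RealLinearAlgebra {c ℓ₁ ℓ₂ ℓ₃} (ℝ : RealNumbers c ℓ₁ ℓ₂ ℓ₃) where

  open LinearAlgebra ℝ public
  open RealNumbers ℝ public
    using (_·_; _<_; _#_; heytingCommutativeRing; isStrictPartialOrder; #⇔<⊎>; +-monoˡ-<; *-pos;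
           tight; #⇒invertible; #-irrefl)
  open HeytingCommutativeRing heytingCommutativeRing public using (commutativeRing)
  open CommutativeRing commutativeRing public hiding (zero; _≉_)
  open Algebra.Apartness.Properties.HeytingCommutativeRing heytingCommutativeRing public
    using (1#0; x-0≈x; x#0y#0→xy#0)
  open Algebra.Properties.Semiring.Sum semiring public
    using (sum; sum-syntax; sum-replicate-zero; ∑-distrib-+; ∑-comm;
           *-distribˡ-sum; *-distribʳ-sum; sum-remove)
    renaming (sum-cong-≋ to sum-cong)
  open Algebra.Properties.Ring ring public
    using (-‿distribˡ-*; -‿distribʳ-*; -1*x≈-x; -‿involutive; x∙y⁻¹≈ε⇒x≈y; +-cancelʳ)
  open Algebra.Properties.Monoid.Mult +-monoid public using (×-homo-+; ×-congʳ)
  open Algebra.Properties.CommutativeMonoid.Mult +-commutativeMonoid public using (×-distrib-+)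
  open Algebra.Properties.Semiring.Mult semiring public using (×-assoc-*)
  open Algebra.Solver.Ring.NaturalCoefficients.Default commutativeSemiring public
    using (solve; _:=_; _:+_; _:*_; con)
  open IsStrictPartialOrder isStrictPartialOrder public using ()
    renaming (irrefl to <-irrefl; trans to <-trans; <-respʳ-≈ to <-respʳ; <-respˡ-≈ to <-respˡ)
  open Relation.Binary.Reasoning.Setoid setoid

  -- Finite sums, matrix action and the Laplacian of a graph

  [_] : Bool → Carrier
  [ b ] = if b then 1# else 0#

  sum-zero : ∀ {n} (t : Fin n → Carrier) → (∀ i → t i ≈ 0#) → sum t ≈ 0#
  sum-zero {n} t t≈0 = trans (sum-cong t≈0) (sum-replicate-zero n)

  sum-single : (xs : List I) (v : Vector I) {a : I} → Unique xs → a List.∈ xs →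
               (∀ b → b ≢ a → v b ≈ 0#) → sum (λ i → v (lookupᴸ xs i)) ≈ v a
  sum-single (x ∷ xs) v {a} (x∉xs ∷ _) (here ≡.refl) v≈0 =
    trans (+-congˡ (rest xs x∉xs)) (+-identityʳ _)
    where
    rest : ∀ ys → All (a ≢_) ys → sum (λ i → v (lookupᴸ ys i)) ≈ 0#
    rest []       All.[]         = refl
    rest (y ∷ ys) (a≢y All.∷ a≢) =
      trans (+-cong (v≈0 y (a≢y ∘ ≡.sym)) (rest ys a≢)) (+-identityˡ 0#)
  sum-single (x ∷ xs) v {a} (x∉xs ∷ u) (there a∈xs) v≈0 =
    trans (+-cong (v≈0 x (All.lookup x∉xs a∈xs)) (sum-single xs v u a∈xs v≈0)) (+-identityˡ _)

  length-filter : ∀ {p} {P : Pred I p} (P? : Decidable P) xs →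
                  length (filter P? xs) · 1# ≈ sum (λ i → [ does (P? (lookupᴸ xs i)) ])
  length-filter P? []       = refl
  length-filter P? (x ∷ xs) with does (P? x)
  ... | true  = +-congˡ (length-filter P? xs)
  ... | false = trans (length-filter P? xs) (sym (+-identityˡ _))

  sum-single-Fin : ∀ {n} (t : Fin n → Carrier) a → (∀ b → b ≢ a → t b ≈ 0#) → sum t ≈ t a
  sum-single-Fin t zero    t≈0 =
    trans (+-congˡ (sum-zero (t ∘ suc) (λ i → t≈0 (suc i) (λ ())))) (+-identityʳ _)
  sum-single-Fin t (suc a) t≈0 =
    trans (+-cong (t≈0 zero (λ ()))
                  (sum-single-Fin (t ∘ suc) a (λ b b≢a → t≈0 (suc b) λ { ≡.refl → b≢a ≡.refl })))
          (+-identityˡ _)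

  module _ {{_ : Finite I}} where

    sumOver-cong : {u v : Vector I} → u ≋ v → sumOver u ≈ sumOver v
    sumOver-cong u≋v = sum-cong (λ i → u≋v (lookupᴸ elements i))

    sumOver-single : (v : Vector I) (a : I) → (∀ b → b ≢ a → v b ≈ 0#) → sumOver v ≈ v a
    sumOver-single v a = sum-single elements v unique (exhaustive a)

    sumOver-zero : (v : Vector I) → v ≋ 0ᵥ → sumOver v ≈ 0#
    sumOver-zero v v≋0 = sum-zero _ (λ i → v≋0 (lookupᴸ elements i))

    sumOver-+ : (u v : Vector I) → sumOver (λ a → u a + v a) ≈ sumOver u + sumOver v
    sumOver-+ u v = ∑-distrib-+ (λ i → u (lookupᴸ elements i)) (λ i → v (lookupᴸ elements i))

    sumOver-*ˡ : ∀ x (v : Vector I) → x * sumOver v ≈ sumOver (x *ₛ v)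
    sumOver-*ˡ x v = *-distribˡ-sum x (λ i → v (lookupᴸ elements i))

    sumOver-*ʳ : ∀ x (v : Vector I) → sumOver v * x ≈ sumOver (λ a → v a * x)
    sumOver-*ʳ x v = *-distribʳ-sum x (λ i → v (lookupᴸ elements i))

    sumOver-sum : ∀ {m} (f : I → Fin m → Carrier) →
                  sumOver (λ a → sum (f a)) ≈ sum (λ i → sumOver (λ a → f a i))
    sumOver-sum f = ∑-comm (λ i → f (lookupᴸ elements i))

    sumOver-δ : (v : Vector I) (a : I) → sumOver (λ b → [ does (a ≟ b) ] * v b) ≈ v a
    sumOver-δ v a = trans
      (sumOver-single _ a λ b b≢a →
        trans (*-congʳ (reflexive (≡.cong [_] (dec-false (a ≟ b) (b≢a ∘ ≡.sym))))) (zeroˡ (v b)))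
      (trans (*-congʳ (reflexive (≡.cong [_] (dec-true (a ≟ a) ≡.refl)))) (*-identityˡ (v a)))

  sumOver-comm : {{_ : Finite I}} {{_ : Finite J}} (f : I → J → Carrier) →
                 sumOver (λ a → sumOver (f a)) ≈ sumOver (λ b → sumOver (λ a → f a b))
  sumOver-comm f = ∑-comm (λ i j → f (lookupᴸ elements i) (lookupᴸ elements j))

  -- No permutation of the list `elements` is constructed. Each `v (f a)` is expanded with a
  -- Kronecker delta, the sums are exchanged, and `f a ≡ b` is traded for `g b ≡ a`.
  sumOver-reindex : {{_ : Finite I}} (f g : I → I) → (∀ a → f (g a) ≡ a) → (∀ a → g (f a) ≡ a) →
                    (v : Vector I) → sumOver (v ∘ f) ≈ sumOver v
  sumOver-reindex f g fg gf v = begin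
    sumOver (v ∘ f)                                              ≈⟨ sumOver-cong (λ a → sumOver-δ v (f a)) ⟨
    sumOver (λ a → sumOver (λ b → [ does (f a ≟ b) ] * v b))
      ≈⟨ sumOver-comm (λ a b → [ does (f a ≟ b) ] * v b) ⟩
    sumOver (λ b → sumOver (λ a → [ does (f a ≟ b) ] * v b))
      ≈⟨ sumOver-cong (λ b → sumOver-cong (λ a → *-congʳ {v b} (reflexive (≡.cong [_] (dec≡ a b))))) ⟩
    sumOver (λ b → sumOver (λ a → [ does (g b ≟ a) ] * v b))
      ≈⟨ sumOver-cong (λ b → sumOver-δ (λ _ → v b) (g b)) ⟩
    sumOver v                                                    ∎
    where
    dec≡ : ∀ a b → does (f a ≟ b) ≡ does (g b ≟ a)
    dec≡ a b = does-≡ (map′ (λ fa≡b → ≡.trans (≡.cong g (≡.sym fa≡b)) (gf a))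
                            (λ gb≡a → ≡.trans (≡.cong f (≡.sym gb≡a)) (fg b))
                            (f a ≟ b))
                      (g b ≟ a)

  sum-sum-single : ∀ {n} (t : Fin n → Fin n → Carrier) a b →
                   (∀ a′ b′ → ¬ (a′ ≡ a × b′ ≡ b) → t a′ b′ ≈ 0#) →
                   ∑[ a′ < n ] ∑[ b′ < n ] t a′ b′ ≈ t a b
  sum-sum-single {n} t a b t≈0 = trans
    (sum-single-Fin (λ a′ → sum (t a′)) a λ a′ a′≢a → sum-zero (t a′) λ b′ → t≈0 a′ b′ (a′≢a ∘ proj₁))
    (sum-single-Fin (t a) b λ b′ b′≢b → t≈0 a b′ (b′≢b ∘ proj₂))

  module _ {{_ : Finite I}} {{_ : Finite J}} (M : Matrix I J) where

    *ᵥ-cong : {u v : Vector J} → u ≋ v → M *ᵥ u ≋ M *ᵥ v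
    *ᵥ-cong u≋v a = sumOver-cong (λ b → *-congˡ {M a b} (u≋v b))

    *ᵥ-scale : ∀ x v → M *ᵥ (x *ₛ v) ≋ x *ₛ (M *ᵥ v)
    *ᵥ-scale x v a = trans
      (sumOver-cong (λ b → shuffle (M a b) x (v b)))
      (sym (sumOver-*ˡ x (λ b → M a b * v b)))
      where
      shuffle : ∀ m x v → m * (x * v) ≈ x * (m * v)
      shuffle = solve 3 (λ m x v → m :* (x :* v) := x :* (m :* v)) refl

    *ᵥ-+ : ∀ u v → M *ᵥ (λ b → u b + v b) ≋ (λ a → (M *ᵥ u) a + (M *ᵥ v) a)
    *ᵥ-+ u v a = trans (sumOver-cong (λ b → distribˡ (M a b) (u b) (v b)))
                       (sumOver-+ (λ b → M a b * u b) (λ b → M a b * v b))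

    *ᵥ-sub : ∀ u v → M *ᵥ (λ b → u b - v b) ≋ (λ a → (M *ᵥ u) a - (M *ᵥ v) a)
    *ᵥ-sub u v a = trans (*ᵥ-+ u (λ b → - v b) a) (+-congˡ (begin
      sumOver (λ b → M a b * - v b)    ≈⟨ sumOver-cong (λ b → -‿distribʳ-* (M a b) (v b)) ⟨
      sumOver (λ b → - (M a b * v b))  ≈⟨ sumOver-cong (λ b → -1*x≈-x (M a b * v b)) ⟨
      sumOver (λ b → - 1# * (M a b * v b))  ≈⟨ sumOver-*ˡ (- 1#) (λ b → M a b * v b) ⟨
      - 1# * (M *ᵥ v) a    ≈⟨ -1*x≈-x ((M *ᵥ v) a) ⟩
      - (M *ᵥ v) a         ∎))

    *ᵥ-sum : ∀ {r} (v : Fin r → Vector J) →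
             M *ᵥ (λ b → sum (λ i → v i b)) ≋ (λ a → sum (λ i → (M *ᵥ v i) a))
    *ᵥ-sum v a = trans (sumOver-cong (λ b → *-distribˡ-sum (M a b) (λ i → v i b)))
                       (sumOver-sum (λ b i → M a b * v i b))

    *ᵥ-linearCombination : ∀ {r} (x : Fin r → Carrier) (v : Fin r → Vector J) →
      M *ᵥ linearCombination x v ≋ linearCombination x (λ i → M *ᵥ v i)
    *ᵥ-linearCombination x v a = trans (*ᵥ-sum (λ i → x i *ₛ v i) a)
                                       (sum-cong (λ i → *ᵥ-scale (x i) (v i) a))

  -- The degree is the row sum of the adjacency matrix, so the diagonal term contributes one copy of
  -- `f a` for each neighbour.
  laplacian-*ᵥ : {{_ : Finite I}} (G : SimpleGraph I) (f : Vector I) (a : I) →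
    (laplacian G *ᵥ f) a ≈ sumOver (λ b → adjacencyMatrix G a b * (f a - f b))
  laplacian-*ᵥ G f a = begin
    sumOver (λ b → (D b - A b) * f b)                        ≈⟨ sumOver-cong (λ b → split (D b) (A b) (f b)) ⟩
    sumOver (λ b → D b * f b + A b * - f b)
      ≈⟨ sumOver-+ (λ b → D b * f b) (λ b → A b * - f b) ⟩
    sumOver (λ b → D b * f b) + sumOver (λ b → A b * - f b)  ≈⟨ +-congʳ diagonal ⟩
    sumOver (λ b → A b * f a) + sumOver (λ b → A b * - f b)
      ≈⟨ sumOver-+ (λ b → A b * f a) (λ b → A b * - f b) ⟨
    sumOver (λ b → A b * f a + A b * - f b)
      ≈⟨ sumOver-cong (λ b → distribˡ (A b) (f a) (- f b)) ⟨
    sumOver (λ b → A b * (f a - f b))                        ∎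
    where
    A = adjacencyMatrix G a
    D = degreeMatrix G a
    split : ∀ d m x → (d - m) * x ≈ d * x + m * - x
    split d m x = trans (distribʳ x d (- m)) (+-congˡ (trans (sym (-‿distribˡ-* m x)) (-‿distribʳ-* m x)))
    diagonal : sumOver (λ b → D b * f b) ≈ sumOver (λ b → A b * f a)
    diagonal = begin
      sumOver (λ b → D b * f b)  ≈⟨ sumOver-single _ a (λ b b≢a → trans (*-congʳ (reflexive
                                      (≡.cong (if_then degree G a · 1# else 0#)
                                        (dec-false (a ≟ b) (b≢a ∘ ≡.sym))))) (zeroˡ (f b))) ⟩
      D a * f a
        ≈⟨ *-congʳ (reflexive (≡.cong (if_then degree G a · 1# else 0#) (dec-true (a ≟ a) ≡.refl))) ⟩
      degree G a · 1# * f a      ≈⟨ *-congʳ (length-filter (adjacent? G a) elements) ⟩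
      sumOver A * f a            ≈⟨ sumOver-*ʳ (f a) A ⟩
      sumOver (λ b → A b * f a)  ∎

  -- Order and characteristic zero

  #-stable : ∀ {x} → ¬ (x # 0#) → x ≈ 0#
  #-stable = proj₁ (tight _ 0#)

  ≈0⇒¬#0 : ∀ {x} → x ≈ 0# → ¬ (x # 0#)
  ≈0⇒¬#0 = #-irrefl

  positive⇒#0 : ∀ {x} → 0# < x → x # 0#
  positive⇒#0 {x} 0<x = Equivalence.from (#⇔<⊎> x 0#) (inj₂ 0<x)

  <0⇒0<- : ∀ {x} → x < 0# → 0# < - x
  <0⇒0<- {x} x<0 = <-respˡ (-‿inverseʳ x) (<-respʳ (+-identityˡ (- x)) (+-monoˡ-< (- x) x<0))

  0<x² : ∀ {x} → x # 0# → 0# < x * x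
  0<x² {x} x#0 with Equivalence.to (#⇔<⊎> x 0#) x#0
  ... | inj₂ 0<x = *-pos 0<x 0<x
  ... | inj₁ x<0 = <-respʳ -x*-x≈x*x (*-pos (<0⇒0<- x<0) (<0⇒0<- x<0))
    where
    -x*-x≈x*x : - x * - x ≈ x * x
    -x*-x≈x*x = begin
      - x * - x    ≈⟨ -‿distribˡ-* x (- x) ⟨
      - (x * - x)  ≈⟨ -‿cong (-‿distribʳ-* x x) ⟨
      - - (x * x)  ≈⟨ -‿involutive (x * x) ⟩
      x * x        ∎

  +-pos : ∀ {x y} → 0# < x → 0# < y ⊎ y ≈ 0# → 0# < x + y
  +-pos {x} {y} 0<x (inj₁ 0<y) = <-trans 0<y (<-respˡ (+-identityˡ y) (+-monoˡ-< y 0<x))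
  +-pos {x} {y} 0<x (inj₂ y≈0) = <-respʳ (trans (sym (+-identityʳ x)) (+-congˡ (sym y≈0))) 0<x

  0<1 : 0# < 1#
  0<1 = <-respʳ (*-identityˡ 1#) (0<x² 1#0)

  0<suc·1 : ∀ m → 0# < suc m · 1#
  0<suc·1 zero    = +-pos 0<1 (inj₂ refl)
  0<suc·1 (suc m) = +-pos 0<1 (inj₁ (0<suc·1 m))

  -- `suc m · x` is the product of the positive number `suc m · 1#` with `x`. If `x` were apart from
  -- zero, so would be this product; tightness then gives equality.
  suc·-cancel : ∀ m {x} → suc m · x ≈ 0# → x ≈ 0#
  suc·-cancel m {x} mx≈0 = #-stable λ x#0 →
    ≈0⇒¬#0 (trans (trans (×-assoc-* (suc m) 1# x) (×-congʳ (suc m) (*-identityˡ x))) mx≈0)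
           (x#0y#0→xy#0 (positive⇒#0 (0<suc·1 m)) x#0)

  double-injective : ∀ {x y} → x + x ≈ y + y → x ≈ y
  double-injective {x} {y} xx≈yy = x∙y⁻¹≈ε⇒x≈y x y (suc·-cancel 1 (begin
    -- This is `2 · (x - y)` unfolded, whence the trailing zero.
    x - y + (x - y + 0#)
      ≈⟨ solve 2 (λ x y → x :+ y :+ (x :+ y :+ con 0) := (x :+ x) :+ (y :+ y)) refl x (- y) ⟩
    (x + x) + (- y + - y)    ≈⟨ +-congʳ xx≈yy ⟩
    (y + y) + (- y + - y)    ≈⟨ solve 2 (λ y z → (y :+ y) :+ (z :+ z) := (y :+ z) :+ (y :+ z)) refl y (- y) ⟩
    (y - y) + (y - y)        ≈⟨ +-cong (-‿inverseʳ y) (-‿inverseʳ y) ⟩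
    0# + 0#                  ≈⟨ +-identityˡ 0# ⟩
    0#                       ∎))

  -- Injectivity of the binomial matrix

  ·-zero : ∀ m {x} → x ≈ 0# → m · x ≈ 0#
  ·-zero zero    x≈0 = refl
  ·-zero (suc m) x≈0 = trans (+-cong x≈0 (·-zero m x≈0)) (+-identityˡ 0#)

  zero+zero : ∀ {x y} → x ≈ 0# → y ≈ 0# → x + y ≈ 0#
  zero+zero x≈0 y≈0 = trans (+-cong x≈0 y≈0) (+-identityˡ 0#)

  cancel-zeroˡ : ∀ {x y} → x ≈ 0# → x + y ≈ 0# → y ≈ 0#
  cancel-zeroˡ x≈0 x+y≈0 = trans (trans (sym (+-identityˡ _)) (+-congʳ (sym x≈0))) x+y≈0

  cancel-zeroʳ : ∀ {x y} → y ≈ 0# → x + y ≈ 0# → x ≈ 0#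
  cancel-zeroʳ y≈0 x+y≈0 = cancel-zeroˡ y≈0 (trans (+-comm _ _) x+y≈0)

  -- ζ v A is the sum of v over all subsets of A.
  ζ : (Subset n → Carrier) → Subset n → Carrier
  ζ v []            = v []
  ζ v (outside ∷ A) = ζ (v ∘ (outside ∷_)) A
  ζ v (inside  ∷ A) = ζ (v ∘ (outside ∷_)) A + ζ (v ∘ (inside ∷_)) A

  -- ∂ F A is the sum of F (A − a) over a ∈ A.
  ∂ : (Subset n → Carrier) → Subset n → Carrier
  ∂ F []            = 0#
  ∂ F (outside ∷ A) = ∂ (F ∘ (outside ∷_)) A
  ∂ F (inside  ∷ A) = F (outside ∷ A) + ∂ (F ∘ (inside ∷_)) A

  ζ-cong : {u v : Subset n → Carrier} → (∀ X → u X ≈ v X) → ∀ A → ζ u A ≈ ζ v A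
  ζ-cong u≈v []            = u≈v []
  ζ-cong u≈v (outside ∷ A) = ζ-cong (u≈v ∘ (outside ∷_)) A
  ζ-cong u≈v (inside  ∷ A) = +-cong (ζ-cong (u≈v ∘ (outside ∷_)) A) (ζ-cong (u≈v ∘ (inside ∷_)) A)

  ζ-zero : {v : Subset n → Carrier} → (∀ X → v X ≈ 0#) → ∀ A → ζ v A ≈ 0#
  ζ-zero v≈0 []            = v≈0 []
  ζ-zero v≈0 (outside ∷ A) = ζ-zero (v≈0 ∘ (outside ∷_)) A
  ζ-zero v≈0 (inside  ∷ A) = zero+zero (ζ-zero (v≈0 ∘ (outside ∷_)) A) (ζ-zero (v≈0 ∘ (inside ∷_)) A)

  interchange : ∀ w x y z → (w + x) + (y + z) ≈ (w + y) + (x + z)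
  interchange = solve 4 (λ w x y z → (w :+ x) :+ (y :+ z) := (w :+ y) :+ (x :+ z)) refl

  ζ-+ : ∀ (u v : Subset n → Carrier) A → ζ (λ X → u X + v X) A ≈ ζ u A + ζ v A
  ζ-+ u v []            = refl
  ζ-+ u v (outside ∷ A) = ζ-+ (u ∘ (outside ∷_)) (v ∘ (outside ∷_)) A
  ζ-+ u v (inside  ∷ A) = trans
    (+-cong (ζ-+ (u ∘ (outside ∷_)) (v ∘ (outside ∷_)) A) (ζ-+ (u ∘ (inside ∷_)) (v ∘ (inside ∷_)) A))
    (interchange _ _ _ _)

  ζ-· : ∀ m (v : Subset n → Carrier) A → ζ (λ X → m · v X) A ≈ m · ζ v A
  ζ-· m v []            = refl
  ζ-· m v (outside ∷ A) = ζ-· m (v ∘ (outside ∷_)) A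
  ζ-· m v (inside  ∷ A) = trans
    (+-cong (ζ-· m (v ∘ (outside ∷_)) A) (ζ-· m (v ∘ (inside ∷_)) A))
    (sym (×-distrib-+ _ _ m))

  ∂-+ : ∀ (F H : Subset n → Carrier) A → ∂ (λ B → F B + H B) A ≈ ∂ F A + ∂ H A
  ∂-+ F H []            = sym (+-identityˡ 0#)
  ∂-+ F H (outside ∷ A) = ∂-+ (F ∘ (outside ∷_)) (H ∘ (outside ∷_)) A
  ∂-+ F H (inside  ∷ A) = trans (+-congˡ (∂-+ (F ∘ (inside ∷_)) (H ∘ (inside ∷_)) A)) (interchange _ _ _ _)

  ∂-zero : ∀ (F : Subset n → Carrier) A → (∀ B → suc ∣ B ∣ ≡ ∣ A ∣ → F B ≈ 0#) → ∂ F A ≈ 0#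
  ∂-zero F []            F≈0 = refl
  ∂-zero F (outside ∷ A) F≈0 = ∂-zero (F ∘ (outside ∷_)) A (F≈0 ∘ (outside ∷_))
  ∂-zero F (inside  ∷ A) F≈0 = zero+zero (F≈0 (outside ∷ A) ≡.refl)
    (∂-zero (F ∘ (inside ∷_)) A (λ B eq → F≈0 (inside ∷ B) (≡.cong suc eq)))

  -- A pair X ⊆ A is counted once for each a ∈ A, either with a ∉ X or with a ∈ X.
  ∂-ζ : ∀ (v : Subset n → Carrier) A → ∂ (ζ v) A + ζ (λ X → ∣ X ∣ · v X) A ≈ ∣ A ∣ · ζ v A
  ∂-ζ v []            = +-identityˡ 0#
  ∂-ζ v (outside ∷ A) = ∂-ζ (v ∘ (outside ∷_)) A
  ∂-ζ v (inside  ∷ A) = begin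
    z₀ + ∂ (λ B → ζ v₀ B + ζ v₁ B) A + (w₀ + ζ (λ X → v₁ X + ∣ X ∣ · v₁ X) A)
      ≈⟨ +-cong (+-congˡ (∂-+ (ζ v₀) (ζ v₁) A)) (+-congˡ (ζ-+ v₁ (λ X → ∣ X ∣ · v₁ X) A)) ⟩
    z₀ + (∂ (ζ v₀) A + ∂ (ζ v₁) A) + (w₀ + (z₁ + w₁))
      ≈⟨ solve 6 (λ z₀ d₀ d₁ w₀ z₁ w₁ → z₀ :+ (d₀ :+ d₁) :+ (w₀ :+ (z₁ :+ w₁))
                                    := (z₀ :+ z₁) :+ ((d₀ :+ w₀) :+ (d₁ :+ w₁))) refl
           z₀ (∂ (ζ v₀) A) (∂ (ζ v₁) A) w₀ z₁ w₁ ⟩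
    (z₀ + z₁) + ((∂ (ζ v₀) A + w₀) + (∂ (ζ v₁) A + w₁))
      ≈⟨ +-congˡ (+-cong (∂-ζ v₀ A) (∂-ζ v₁ A)) ⟩
    (z₀ + z₁) + (∣ A ∣ · z₀ + ∣ A ∣ · z₁)
      ≈⟨ +-congˡ (×-distrib-+ z₀ z₁ ∣ A ∣) ⟨
    (z₀ + z₁) + ∣ A ∣ · (z₀ + z₁) ∎
    where
    v₀ = v ∘ (outside ∷_)
    v₁ = v ∘ (inside ∷_)
    z₀ = ζ v₀ A
    z₁ = ζ v₁ A
    w₀ = ζ (λ X → ∣ X ∣ · v₀ X) A
    w₁ = ζ (λ X → ∣ X ∣ · v₁ X) A

  -- Stands in for a vector on the `h`-subsets. Defined on all subsets, such functions can be split
  -- by the first point without carrying proofs about sizes.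
  Graded : ℕ → (Subset n → Carrier) → Set ℓ₁
  Graded h v = ∀ X → ∣ X ∣ ≢ h → v X ≈ 0#

  VanishesAt : ℕ → (Subset n → Carrier) → Set ℓ₁
  VanishesAt k F = ∀ A → ∣ A ∣ ≡ k → F A ≈ 0#

  Graded-inside : {v : Subset (suc n) → Carrier} → Graded (suc h) v → Graded h (v ∘ (inside ∷_))
  Graded-inside graded X ∣X∣≢h = graded (inside ∷ X) (∣X∣≢h ∘ ℕ.suc-injective)

  -- Double counting: an `h`-subset of a set `A` of size `k + 1` avoids `k + 1 − h` points of `A`,
  -- so that multiple of `ζ v A` is the sum of `ζ v` over the `k`-subsets of `A`. The multiple is
  -- positive because `h ≤ k`.
  ζ-vanishes-suc : {v : Subset n → Carrier} → h ≤ k → Graded h v →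
                   VanishesAt k (ζ v) → VanishesAt (suc k) (ζ v)
  ζ-vanishes-suc {h = h} {k = k} {v} h≤k graded vanishes A ∣A∣≡1+k =
    suc·-cancel (k ℕ.∸ h) (+-cancelʳ (h · ζ v A) _ 0# (begin
      suc (k ℕ.∸ h) · ζ v A + h · ζ v A    ≈⟨ ×-homo-+ (ζ v A) (suc (k ℕ.∸ h)) h ⟨
      (suc (k ℕ.∸ h) ℕ.+ h) · ζ v A        ≡⟨ ≡.cong (_· ζ v A) (≡.cong suc (ℕ.m∸n+n≡m h≤k)) ⟩
      suc k · ζ v A                        ≡⟨ ≡.cong (_· ζ v A) ∣A∣≡1+k ⟨
      ∣ A ∣ · ζ v A                        ≈⟨ ∂-ζ v A ⟨
      ∂ (ζ v) A + ζ (λ X → ∣ X ∣ · v X) A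
        ≈⟨ +-cong (∂-zero (ζ v) A (λ B eq → vanishes B (ℕ.suc-injective (≡.trans eq ∣A∣≡1+k))))
                                                     (trans (ζ-cong weight A) (ζ-· h v A)) ⟩
      0# + h · ζ v A                       ∎))
    where
    weight : ∀ X → ∣ X ∣ · v X ≈ h · v X
    weight X with ∣ X ∣ ℕ.≟ h
    ... | yes ∣X∣≡h = reflexive (≡.cong (_· v X) ∣X∣≡h)
    ... | no  ∣X∣≢h = trans (·-zero ∣ X ∣ (graded X ∣X∣≢h)) (sym (·-zero h (graded X ∣X∣≢h)))

  -- A set of size `h` has only itself as `h`-subset, so the binomial matrix is the identity here.
  -- The case is kept apart because the extremal step below lowers `k` while keeping `h`, which
  -- needs `h < k`.
  ζ-injective-diagonal : (v : Subset n → Carrier) → Graded h v → VanishesAt h (ζ v) → ∀ X → v X ≈ 0#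
  ζ-injective-diagonal {h = h} v graded vanishes [] with 0 ℕ.≟ h
  ... | yes 0≡h = vanishes [] 0≡h
  ... | no  0≢h = graded [] 0≢h
  ζ-injective-diagonal {h = h} v graded vanishes (outside ∷ X) =
    ζ-injective-diagonal (v ∘ (outside ∷_)) (graded ∘ (outside ∷_)) (vanishes ∘ (outside ∷_)) X
  ζ-injective-diagonal {h = zero}  v graded vanishes (inside ∷ X) = graded (inside ∷ X) (λ ())
  ζ-injective-diagonal {h = suc h} v graded vanishes (inside ∷ X) =
    ζ-injective-diagonal (v ∘ (inside ∷_)) (Graded-inside graded)
      (λ A ∣A∣≡h → cancel-zeroˡ
        (ζ-zero (ζ-injective-diagonal (v ∘ (outside ∷_)) (graded ∘ (outside ∷_)) (vanishes ∘ (outside ∷_))) A)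
        (vanishes (inside ∷ A) (≡.cong suc ∣A∣≡h)))
      X

  ζ-injective : ∀ n {h k} (v : Subset n → Carrier) → h ≤ k → h ℕ.+ k ≤ n →
                Graded h v → VanishesAt k (ζ v) → ∀ X → v X ≈ 0#
  ζ-injective n {h} {k} v h≤k h+k≤n graded vanishes with h ℕ.≟ k
  ... | yes ≡.refl = ζ-injective-diagonal v graded vanishes
  ... | no h≢k = strict n k v (ℕ.≤∧≢⇒< h≤k h≢k) h+k≤n graded vanishes
    where
    strict : ∀ n k (v : Subset n → Carrier) → h ℕ.< k → h ℕ.+ k ≤ n →
             Graded h v → VanishesAt k (ζ v) → ∀ X → v X ≈ 0#
    strict zero k v h<k h+k≤n _ _ with ℕ.≤-trans h<k (ℕ.≤-trans (ℕ.m≤n+m k h) h+k≤n)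
    ... | ()
    strict (suc n) (suc k) v (s≤s h≤k) h+k≤n graded vanishes with h ℕ.+ suc k ℕ.≤? n
    -- The same sizes still fit on `n` points. Sets avoiding the chosen point give `v₀`; once it
    -- vanishes, the sums over sets containing the point are sums of `v₁`.
    ... | yes h+k≤n = λ { (outside ∷ X) → v₀≈0 X ; (inside ∷ X) → v₁≈0 h h≤k h+k≤n graded X }
      where
      v₀≈0 : ∀ X → v (outside ∷ X) ≈ 0#
      v₀≈0 = ζ-injective n (v ∘ (outside ∷_)) (ℕ.m≤n⇒m≤1+n h≤k) h+k≤n (graded ∘ (outside ∷_)) (vanishes ∘ (outside ∷_))
      -- `h` is quantified anew so that it can be split: for `h = 0` a set containing the chosen
      -- point has the wrong size.
      v₁≈0 : ∀ h → h ≤ k → h ℕ.+ suc k ≤ n → Graded h v → ∀ X → v (inside ∷ X) ≈ 0#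
      v₁≈0 zero    _   _     graded X = graded (inside ∷ X) (λ ())
      v₁≈0 (suc h) h<k h+k<n graded =
        ζ-injective n (v ∘ (inside ∷_)) (ℕ.<⇒≤ h<k)
          (ℕ.≤-trans (ℕ.+-mono-≤ (ℕ.n≤1+n h) (ℕ.n≤1+n k)) h+k<n) (Graded-inside graded)
          (λ A ∣A∣≡k → cancel-zeroˡ (ζ-zero v₀≈0 A) (vanishes (inside ∷ A) (≡.cong suc ∣A∣≡k)))
    -- Now `h + suc k` equals `suc n`. The sums of `v` vanish on sets of sizes `suc k` and
    -- `suc (suc k)`, and adding the chosen point to a set changes the sum by one of `v₁`. So `v₁`
    -- comes first, at size `suc k`, and `v₀` follows at size `k`.
    ... | no  _ = λ { (outside ∷ X) → v₀≈0 X ; (inside ∷ X) → v₁≈0 X }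
      where
      v₁-vanishes : VanishesAt (suc k) (ζ (v ∘ (inside ∷_)))
      v₁-vanishes A ∣A∣≡k = cancel-zeroˡ (vanishes (outside ∷ A) ∣A∣≡k)
        (ζ-vanishes-suc {v = v} (ℕ.m≤n⇒m≤1+n h≤k) graded vanishes (inside ∷ A) (≡.cong suc ∣A∣≡k))
      v₁≈0′ : ∀ h → h ≤ k → h ℕ.+ suc k ≤ suc n → Graded h v → ∀ X → v (inside ∷ X) ≈ 0#
      v₁≈0′ zero    _   _   graded X = graded (inside ∷ X) (λ ())
      v₁≈0′ (suc h) h<k (s≤s h+k≤n) graded =
        ζ-injective n (v ∘ (inside ∷_)) (ℕ.m≤n⇒m≤1+n (ℕ.<⇒≤ h<k)) h+k≤n (Graded-inside graded) v₁-vanishes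
      v₁≈0 = v₁≈0′ h h≤k h+k≤n graded
      v₀≈0 : ∀ X → v (outside ∷ X) ≈ 0#
      v₀≈0 = ζ-injective n (v ∘ (outside ∷_)) h≤k
        (s≤s⁻¹ (≡.subst (_≤ suc n) (ℕ.+-suc h k) h+k≤n)) (graded ∘ (outside ∷_))
        (λ A ∣A∣≡k → cancel-zeroʳ (ζ-zero v₁≈0 A) (vanishes (inside ∷ A) (≡.cong suc ∣A∣≡k)))

  -- The binomial matrix as a subset sum

  sumList : ∀ {A : Set} → List A → (A → Carrier) → Carrier
  sumList xs v = sum (λ i → v (lookupᴸ xs i))

  sumList-map : ∀ {A B : Set} (f : A → B) xs (v : B → Carrier) → sumList (map f xs) v ≡ sumList xs (v ∘ f)
  sumList-map f []       v = ≡.refl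
  sumList-map f (x ∷ xs) v = ≡.cong (v (f x) +_) (sumList-map f xs v)

  sumList-++ : ∀ {A : Set} xs ys (v : A → Carrier) → sumList (xs ++ ys) v ≈ sumList xs v + sumList ys v
  sumList-++ []       ys v = sym (+-identityˡ _)
  sumList-++ (x ∷ xs) ys v = trans (+-congˡ (sumList-++ xs ys v)) (sym (+-assoc _ _ _))

  incidence : Subset n → (Subset n → Carrier) → KSubset n h → Carrier
  incidence A v (X , _) = [ does (X ⊆? A) ] * v X

  -- `kSubsets` and `ζ` branch alike on the first point, and the test `X ⊆? A` reduces along with
  -- them. A branch present on one side only is zero: sets through a point outside `A` fail the
  -- test, and for `h = 0` sets through any point have the wrong size.
  binomial-ζ : ∀ n h A (v : Subset n → Carrier) → Graded h v →
               sumList (kSubsets n h) (incidence A v) ≈ ζ v A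
  binomial-ζ zero zero [] v graded = trans (+-identityʳ _) (*-identityˡ (v []))
  binomial-ζ zero (suc h) [] v graded = sym (graded [] (λ ()))
  binomial-ζ (suc n) zero (outside ∷ A) v graded = trans
    (reflexive (sumList-map _ (kSubsets n zero) (incidence (outside ∷ A) v)))
    (binomial-ζ n zero A (v ∘ (outside ∷_)) (graded ∘ (outside ∷_)))
  binomial-ζ (suc n) zero (inside ∷ A) v graded = trans
    (reflexive (sumList-map _ (kSubsets n zero) (incidence (inside ∷ A) v)))
    (trans (binomial-ζ n zero A (v ∘ (outside ∷_)) (graded ∘ (outside ∷_)))
      (trans (sym (+-identityʳ _)) (+-congˡ (sym (ζ-zero (λ X → graded (inside ∷ X) (λ ())) A)))))
  binomial-ζ (suc n) (suc h) (outside ∷ A) v graded = trans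
    (sumList-++ (map _ (kSubsets n h)) (map _ (kSubsets n (suc h))) (incidence (outside ∷ A) v))
    (trans
      (+-cong
        (trans (reflexive (sumList-map _ (kSubsets n h) (incidence (outside ∷ A) v)))
               (sum-zero {length (kSubsets n h)} _ (λ i → zeroˡ (v (inside ∷ proj₁ (lookupᴸ (kSubsets n h) i))))))
        (trans (reflexive (sumList-map _ (kSubsets n (suc h)) (incidence (outside ∷ A) v)))
               (binomial-ζ n (suc h) A (v ∘ (outside ∷_)) (graded ∘ (outside ∷_)))))
      (+-identityˡ _))
  binomial-ζ (suc n) (suc h) (inside ∷ A) v graded = trans
    (sumList-++ (map _ (kSubsets n h)) (map _ (kSubsets n (suc h))) (incidence (inside ∷ A) v))
    (trans
      (+-cong
        (trans (reflexive (sumList-map _ (kSubsets n h) (incidence (inside ∷ A) v)))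
               (binomial-ζ n h A (v ∘ (inside ∷_)) (Graded-inside graded)))
        (trans (reflexive (sumList-map _ (kSubsets n (suc h)) (incidence (inside ∷ A) v)))
               (binomial-ζ n (suc h) A (v ∘ (outside ∷_)) (graded ∘ (outside ∷_)))))
      (+-comm _ _))

  extend : Vector (KSubset n h) → Subset n → Carrier
  extend {h = h} v X with ∣ X ∣ ℕ.≟ h
  ... | yes p = v (X , p)
  ... | no  _ = 0#

  extend-graded : (v : Vector (KSubset n h)) → Graded h (extend v)
  extend-graded {h = h} v X ∣X∣≢h with ∣ X ∣ ℕ.≟ h
  ... | yes p = contradiction p ∣X∣≢h
  ... | no  _ = refl

  extend-≡ : (v : Vector (KSubset n h)) (X : KSubset n h) → extend v (proj₁ X) ≡ v X
  extend-≡ {h = h} v (X , p) with ∣ X ∣ ℕ.≟ h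
  ... | yes q = ≡.cong v (KSubset-≡ ≡.refl)
  ... | no ¬p = contradiction p ¬p

  binomialMatrix-injective : h ≤ k → h ℕ.+ k ≤ n → (v : Vector (KSubset n h)) →
                             binomialMatrix n k h *ᵥ v ≋ 0ᵥ → v ≋ 0ᵥ
  binomialMatrix-injective {h} {k} {n} h≤k h+k≤n v Bv≋0 X = trans
    (reflexive (≡.sym (extend-≡ v X)))
    (ζ-injective n (extend v) h≤k h+k≤n (extend-graded v) vanishes (proj₁ X))
    where
    vanishes : VanishesAt k (ζ (extend v))
    vanishes A ∣A∣≡k = begin
      ζ (extend v) A                                       ≈⟨ binomial-ζ n h A (extend v) (extend-graded v) ⟨
      sumList (kSubsets n h) (incidence A (extend v))
        ≈⟨ sum-cong (λ i → *-congˡ (reflexive (extend-≡ v (lookupᴸ (kSubsets n h) i)))) ⟩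
      (binomialMatrix n k h *ᵥ v) (A , ∣A∣≡k)              ≈⟨ Bv≋0 (A , ∣A∣≡k) ⟩
      0#                                                   ∎

  -- Gram matrices, dimension and spectra

  sum-squares-tail : (t : Fin (suc n) → Carrier) → t zero ≈ 0# →
    ∑[ i < suc n ] (t i * t i) ≈ ∑[ i < n ] (t (suc i) * t (suc i))
  sum-squares-tail t t₀≈0 =
    trans (+-congʳ (trans (*-congʳ t₀≈0) (zeroˡ (t zero)))) (+-identityˡ _)

  -- Whether an entry is apart from zero cannot be decided, so the alternative holds only doubly
  -- negated. That suffices for refuting that an entry of a null vector is apart from zero.
  sum-squares-nonneg : (t : Fin n → Carrier) →
    ¬ ¬ (0# < ∑[ i < n ] (t i * t i) ⊎ ∑[ i < n ] (t i * t i) ≈ 0#)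
  sum-squares-nonneg {zero}  t ¬nonneg = ¬nonneg (inj₂ refl)
  sum-squares-nonneg {suc n} t ¬nonneg =
    sum-squares-nonneg (t ∘ suc) λ rest → ¬¬-excluded-middle λ
      { (yes t₀#0) → ¬nonneg (inj₁ (+-pos (0<x² t₀#0) rest))
      ; (no ¬t₀#0) → ¬nonneg (transport (sym (sum-squares-tail t (#-stable ¬t₀#0))) rest)
      }
    where
    transport : ∀ {x y} → x ≈ y → 0# < x ⊎ x ≈ 0# → 0# < y ⊎ y ≈ 0#
    transport x≈y (inj₁ 0<x) = inj₁ (<-respʳ x≈y 0<x)
    transport x≈y (inj₂ x≈0) = inj₂ (trans (sym x≈y) x≈0)

  sum-squares-zero : (t : Fin n → Carrier) → ∑[ i < n ] (t i * t i) ≈ 0# → ∀ i → t i ≈ 0#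
  sum-squares-zero {suc n} t Σt²≈0 = λ
    { zero    → t₀≈0
    ; (suc i) → sum-squares-zero (t ∘ suc) (trans (sym (sum-squares-tail t t₀≈0)) Σt²≈0) i
    }
    where
    t₀≈0 : t zero ≈ 0#
    t₀≈0 = #-stable λ t₀#0 → sum-squares-nonneg (t ∘ suc) λ rest →
      <-irrefl (sym Σt²≈0) (+-pos (0<x² t₀#0) rest)

  sumOver-squares-zero : {{_ : Finite I}} (v : Vector I) → sumOver (λ a → v a * v a) ≈ 0# → v ≋ 0ᵥ
  sumOver-squares-zero v Σv²≈0 a = trans
    (reflexive (≡.cong v (lookup-index (exhaustive a))))
    (sum-squares-zero (λ i → v (lookupᴸ elements i)) Σv²≈0 (index (exhaustive a)))

  module _ {{_ : Finite I}} {{_ : Finite J}} (M : Matrix I J) where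

    *ᵥ-adjoint : ∀ v w → sumOver (λ a → (M *ᵥ v) a * w a) ≈ sumOver (λ b → v b * (M ᵀ *ᵥ w) b)
    *ᵥ-adjoint v w = begin
      sumOver (λ a → (M *ᵥ v) a * w a)
        ≈⟨ sumOver-cong (λ a → sumOver-*ʳ (w a) (λ b → M a b * v b)) ⟩
      sumOver (λ a → sumOver (λ b → M a b * v b * w a))    ≈⟨ sumOver-comm (λ a b → M a b * v b * w a) ⟩
      sumOver (λ b → sumOver (λ a → M a b * v b * w a))
        ≈⟨ sumOver-cong (λ b → sumOver-cong (λ a → rotate (M a b) (v b) (w a))) ⟩
      sumOver (λ b → sumOver (λ a → v b * (M a b * w a)))
        ≈⟨ sumOver-cong (λ b → sumOver-*ˡ (v b) (λ a → M a b * w a)) ⟨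
      sumOver (λ b → v b * (M ᵀ *ᵥ w) b)                   ∎
      where
      rotate : ∀ x y z → x * y * z ≈ y * (x * z)
      rotate = solve 3 (λ x y z → x :* y :* z := y :* (x :* z)) refl

    -- The inner product of `M *ᵥ v` with itself is that of `v` with `M ᵀ *ᵥ (M *ᵥ v)`, hence zero,
    -- and a vanishing sum of real squares has vanishing terms.
    Gram-kernel : ∀ v → M ᵀ *ᵥ (M *ᵥ v) ≋ 0ᵥ → M *ᵥ v ≋ 0ᵥ
    Gram-kernel v MᵀMv≋0 = sumOver-squares-zero (M *ᵥ v) (trans (*ᵥ-adjoint v (M *ᵥ v))
      (sumOver-zero _ (λ b → trans (*-congˡ {v b} (MᵀMv≋0 b)) (zeroʳ (v b)))))

    module _ (injective : ∀ v → M *ᵥ v ≋ 0ᵥ → v ≋ 0ᵥ) {r} (v : Fin r → Vector J)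
             (independent : LinearlyIndependent v) where

      independent-image : LinearlyIndependent (λ i → M *ᵥ v i)
      independent-image x Mv≋0 = independent x (injective (linearCombination x v)
        (λ a → trans (*ᵥ-linearCombination M x v a) (Mv≋0 a)))

      Gram-independent : LinearlyIndependent (λ i → M ᵀ *ᵥ (M *ᵥ v i))
      Gram-independent x MᵀMv≋0 = independent x (injective _ (Gram-kernel (linearCombination x v) λ b →
        trans (*ᵥ-cong (M ᵀ) (*ᵥ-linearCombination M x v) b)
          (trans (*ᵥ-linearCombination (M ᵀ) x (λ i → M *ᵥ v i) b) (MᵀMv≋0 b))))

  -- The bases in `HasMultiplicity` carry only the eigenvalue equation; this supplies the other half
  -- of `IsEigenvector`. A zero vector would be annihilated by the coefficients of the `i`-th unit
  -- vector, forcing `1# ≈ 0#`.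
  independent⇒nonzero : (v : Fin r → Vector I) → LinearlyIndependent v → ∀ i → ¬ (v i ≋ 0ᵥ)
  independent⇒nonzero v independent i vᵢ≋0 = ≈0⇒¬#0 1≈0 1#0
    where
    x : Fin _ → Carrier
    x j = [ does (i ≟ᶠ j) ]
    vanishes : ∀ a j → x j * v j a ≈ 0#
    vanishes a j with i ≟ᶠ j
    ... | yes ≡.refl = trans (*-congˡ (vᵢ≋0 a)) (zeroʳ 1#)
    ... | no _       = zeroˡ (v j a)
    1≈0 : 1# ≈ 0#
    1≈0 = trans (reflexive (≡.cong [_] (≡.sym (dec-true (i ≟ᶠ i) ≡.refl))))
                (independent x (λ a → sum-zero _ (vanishes a)) i)

  -- Bounding the size of an independent family

  inverse : ∀ {x} → x # 0# → ∃[ y ] y * x ≈ 1#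
  inverse x#0 with #⇒invertible x#0
  ... | y , yx≈1 , _ = y , trans (*-congˡ (sym (x-0≈x _))) yx≈1

  IndependentRows : (Fin m → Fin n → Carrier) → Set (c ⊔ ℓ₁)
  IndependentRows {m} C = ∀ (x : Fin m → Carrier) → (∀ j → ∑[ i < m ] (x i * C i j) ≈ 0#) → ∀ i → x i ≈ 0#

  eliminate : (C : Fin (suc m) → Fin (suc n) → Carrier) → Fin (suc m) → (Fin m → Carrier) →
              Fin m → Fin (suc n) → Carrier
  eliminate C p ρ i j = C (punchIn p i) j + ρ i * C p j

  -- A combination of the reduced rows is one of the original rows in which the pivot row receives
  -- the accumulated weight. This carries independence over to the reduced matrix.
  sum-eliminate : ∀ (C : Fin (suc m) → Fin (suc n) → Carrier) p ρ x j →
    ∑[ i < suc m ] (insertAt x p (∑[ i < m ] (x i * ρ i)) i * C i j) ≈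
    ∑[ i < m ] (x i * eliminate C p ρ i j)
  sum-eliminate {m} C p ρ x j = begin
    ∑[ i < suc m ] (y i * C i j)
      ≈⟨ sum-remove {i = p} (λ i → y i * C i j) ⟩
    y p * C p j + ∑[ i < m ] (y (punchIn p i) * C (punchIn p i) j)
      ≈⟨ +-cong (*-congʳ (reflexive (insertAt-lookup x p yₚ)))
                (sum-cong (λ i → *-congʳ (reflexive (insertAt-punchIn x p yₚ i)))) ⟩
    yₚ * C p j + ∑[ i < m ] (x i * C (punchIn p i) j)
      ≈⟨ +-congʳ (*-distribʳ-sum (C p j) (λ i → x i * ρ i)) ⟩
    ∑[ i < m ] (x i * ρ i * C p j) + ∑[ i < m ] (x i * C (punchIn p i) j)
      ≈⟨ ∑-distrib-+ (λ i → x i * ρ i * C p j) (λ i → x i * C (punchIn p i) j) ⟨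
    ∑[ i < m ] (x i * ρ i * C p j + x i * C (punchIn p i) j)
      ≈⟨ sum-cong (λ i → factor (x i) (ρ i) (C p j) (C (punchIn p i) j)) ⟩
    ∑[ i < m ] (x i * eliminate C p ρ i j) ∎
    where
    yₚ = ∑[ i < m ] (x i * ρ i)
    y  = insertAt x p yₚ
    factor : ∀ x ρ c d → x * ρ * c + x * d ≈ x * (d + ρ * c)
    factor = solve 4 (λ x ρ c d → x :* ρ :* c :+ x :* d := x :* (d :+ ρ :* c)) refl

  -- Gaussian elimination.  Whether a pivot exists is undecidable in general,
  -- but the goal is a decidable statement.
  independentRows⇒≤ : ∀ n {m} (C : Fin m → Fin n → Carrier) → IndependentRows C → m ≤ n
  independentRows⇒≤ n       {zero}  C independent = z≤n
  independentRows⇒≤ zero    {suc m} C independent =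
    contradiction 1#0 (≈0⇒¬#0 (independent (λ _ → 1#) (λ ()) zero))
  independentRows⇒≤ (suc n) {suc m} C independent =
    decidable-stable (suc m ℕ.≤? suc n) λ m≰n → ¬¬-excluded-middle {A = ∃[ p ] C p zero # 0#} λ
      { (yes (p , Cₚ₀#0)) → m≰n (s≤s (independentRows⇒≤ n _ (pivot p (inverse Cₚ₀#0))))
      -- Without a pivot the first column vanishes, so deleting it keeps the rows independent and
      -- even gives `suc m ≤ n`.
      ; (no ¬pivot) → m≰n (ℕ.m≤n⇒m≤1+n (independentRows⇒≤ n (λ i j → C i (suc j))
          λ x rest≈0 → independent x
            λ { zero    → sum-zero _ (λ i → trans (*-congˡ (#-stable (λ Cᵢ₀#0 → ¬pivot (i , Cᵢ₀#0)))) (zeroʳ (x i)))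
              ; (suc j) → rest≈0 j }))
      }
    where
    pivot : ∀ p (inv : ∃[ y ] y * C p zero ≈ 1#) →
            IndependentRows (λ i j → eliminate C p (λ i → - (C (punchIn p i) zero * proj₁ inv)) i (suc j))
    pivot p (y , yCₚ₀≈1) x rest≈0 i = trans
      (reflexive (≡.sym (insertAt-punchIn x p _ i)))
      (independent (insertAt x p (∑[ i < m ] (x i * ρ i)))
        (λ { zero    → trans (sum-eliminate C p ρ x zero)
                         (sum-zero _ (λ i → trans (*-congˡ (column₀ i)) (zeroʳ (x i))))
           ; (suc j) → trans (sum-eliminate C p ρ x (suc j)) (rest≈0 j) })
        (punchIn p i))
      where
      ρ : Fin m → Carrier
      ρ i = - (C (punchIn p i) zero * y)
      column₀ : ∀ i → eliminate C p ρ i zero ≈ 0#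
      column₀ i = begin
        cᵢ + - (cᵢ * y) * C p zero    ≈⟨ +-congˡ (-‿distribˡ-* (cᵢ * y) (C p zero)) ⟨
        cᵢ - cᵢ * y * C p zero
          ≈⟨ +-congˡ (-‿cong (trans (*-assoc cᵢ y (C p zero)) (trans (*-congˡ yCₚ₀≈1) (*-identityʳ cᵢ)))) ⟩
        cᵢ - cᵢ                       ≈⟨ -‿inverseʳ cᵢ ⟩
        0#                            ∎
        where cᵢ = C (punchIn p i) zero

  -- The Steinitz bound: a dependency among the rows of the coefficient matrix `C` is a dependency
  -- among the vectors `u`.
  independent-in-span⇒≤ : (u : Fin m → Vector I) (v : Fin n → Vector I) → LinearlyIndependent u →
                          (∀ i → ∃[ x ] u i ≋ linearCombination x v) → m ≤ n
  independent-in-span⇒≤ {m} {n = n} u v independent span = independentRows⇒≤ n C λ x xC≈0 →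
    independent x λ a → begin
      ∑[ i < m ] (x i * u i a)                             ≈⟨ sum-cong (λ i → *-congˡ (proj₂ (span i) a)) ⟩
      ∑[ i < m ] (x i * ∑[ j < n ] (C i j * v j a))
        ≈⟨ sum-cong (λ i → *-distribˡ-sum (x i) (λ j → C i j * v j a)) ⟩
      ∑[ i < m ] ∑[ j < n ] (x i * (C i j * v j a))        ≈⟨ ∑-comm (λ i j → x i * (C i j * v j a)) ⟩
      ∑[ j < n ] ∑[ i < m ] (x i * (C i j * v j a))
        ≈⟨ sum-cong (λ j → sum-cong (λ i → *-assoc (x i) (C i j) (v j a))) ⟨
      ∑[ j < n ] ∑[ i < m ] (x i * C i j * v j a)
        ≈⟨ sum-cong (λ j → *-distribʳ-sum (v j a) (λ i → x i * C i j)) ⟨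
      ∑[ j < n ] (∑[ i < m ] (x i * C i j) * v j a)
        ≈⟨ sum-zero _ (λ j → trans (*-congʳ (xC≈0 j)) (zeroˡ (v j a))) ⟩
      0#                                                   ∎
    where
    C : Fin m → Fin n → Carrier
    C i = proj₁ (span i)

  -- Spectra under an intertwining matrix

  module _ {{_ : Finite I}} {{_ : Finite J}} (N : Matrix I I) (L : Matrix J J) (M : Matrix I J)
           (intertwine : ∀ v → N *ᵥ (M *ᵥ v) ≋ M *ᵥ (L *ᵥ v)) where

    eigenspace-image : ∀ {μ v} → L *ᵥ v ≋ μ *ₛ v → N *ᵥ (M *ᵥ v) ≋ μ *ₛ (M *ᵥ v)
    eigenspace-image {μ} {v} Lv≋μv a =
      trans (intertwine v a) (trans (*ᵥ-cong M Lv≋μv a) (*ᵥ-scale M μ v a))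

    eigenvector-image : ∀ {μ v} → IsEigenvector L μ v → ¬ (M *ᵥ v ≋ 0ᵥ) → IsEigenvector N μ (M *ᵥ v)
    eigenvector-image (_ , Lv≋μv) Mv≢0 = Mv≢0 , eigenspace-image Lv≋μv

    module _ (injective : ∀ v → M *ᵥ v ≋ 0ᵥ → v ≋ 0ᵥ) where

      -- An eigenbasis of `L` is mapped to independent vectors in the eigenspace of `N`, which
      -- cannot outnumber a basis of that eigenspace.
      spectrumContained : SpectrumContained L N
      spectrumContained =
        (λ μ (v , eigen@(v≢0 , _)) → M *ᵥ v , eigenvector-image eigen (v≢0 ∘ injective v)) ,
        (λ μ m m′ U V → let open HasMultiplicity in
          independent-in-span⇒≤ (λ i → M *ᵥ basis U i) (basis V)
            (independent-image M injective (basis U) (independent U))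
            (λ i → spanning V (M *ᵥ basis U i) (eigenspace-image (eigen U i))))

-- The token Laplacian as a sum over transpositions

module TokenGraph {c ℓ₁ ℓ₂ ℓ₃} (ℝ : RealNumbers c ℓ₁ ℓ₂ ℓ₃) {n} (G : SimpleGraph (Fin n)) where

  open RealLinearAlgebra ℝ
  open Relation.Binary.Reasoning.Setoid setoid

  sum²-cong : {s t : Fin n → Fin n → Carrier} → (∀ a b → s a b ≈ t a b) →
              ∑[ a < n ] ∑[ b < n ] s a b ≈ ∑[ a < n ] ∑[ b < n ] t a b
  sum²-cong s≈t = sum-cong (λ a → sum-cong (s≈t a))

  sum²-+ : (s t : Fin n → Fin n → Carrier) →
           ∑[ a < n ] ∑[ b < n ] (s a b + t a b) ≈ ∑[ a < n ] ∑[ b < n ] s a b + ∑[ a < n ] ∑[ b < n ] t a b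
  sum²-+ s t = trans (sum-cong (λ a → ∑-distrib-+ (s a) (t a))) (∑-distrib-+ (λ a → sum (s a)) (λ a → sum (t a)))

  -- By `move-unique` at most one move leads from `A` to `C`, so the double sum has at most one
  -- nonzero term.
  tokenAdjacency-sum : (A C : KSubset n k) → adjacencyMatrix (tokenGraph G k) A C ≈
    ∑[ a < n ] ∑[ b < n ] ([ does (movable? G (proj₁ A) a b) ] * [ does (swap a b A ≟ C) ])
  tokenAdjacency-sum {k} A₀@(A , _) C₀@(C , _) = split (adjacent? (tokenGraph G k) A₀ C₀)
    where
    term : Fin n → Fin n → Carrier
    term a b = [ does (movable? G A a b) ] * [ does (swap a b A₀ ≟ C₀) ]

    term≈0 : ∀ a b → ¬ (Movable G A a b × swap a b A₀ ≡ C₀) → term a b ≈ 0#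
    term≈0 a b ¬both = vanish (movable? G A a b) (swap a b A₀ ≟ C₀) ¬both
      where
      vanish : ∀ {P Q : Set} (p : Dec P) (q : Dec Q) → ¬ (P × Q) → [ does p ] * [ does q ] ≈ 0#
      vanish (yes p) (yes q) ¬pq = contradiction (p , q) ¬pq
      vanish (yes _) (no _)  _   = zeroʳ 1#
      vanish (no _)  q       _   = zeroˡ [ does q ]

    split : (d : Dec (TokenAdjacent G A C)) → [ does d ] ≈ ∑[ a < n ] ∑[ b < n ] term a b
    split (yes (a , b , a∈A , b∈C , A△C , ab)) with △-pair⇒permute a∈A b∈C A△C
    ... | b∉A , moved = begin
      1#                                ≈⟨ *-identityˡ 1# ⟨
      1# * 1#
        ≈⟨ *-cong (reflexive (≡.cong [_] (dec-true (movable? G A a b) (a∈A , b∉A , ab))))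
                                                  (reflexive (≡.cong [_] (dec-true (swap a b A₀ ≟ C₀) (KSubset-≡ moved)))) ⟨
      term a b                          ≈⟨ sum-sum-single term a b (λ a′ b′ ≢ab → term≈0 a′ b′
                                             λ ((a′∈A , b′∉A , _) , eq) → ≢ab (move-unique A a∈A b∉A a′∈A b′∉A
                                               (≡.trans (≡.cong proj₁ eq) (≡.sym moved)))) ⟨
      ∑[ a < n ] ∑[ b < n ] term a b    ∎
    split (no ¬adj) = sym (sum-zero (λ a → sum (term a)) λ a → sum-zero (term a) λ b → term≈0 a b
      λ { ((a∈A , b∉A , ab) , ≡.refl) → ¬adj (a , b , a∈A , right∈permute A a∈A , permute-△ A a∈A b∉A , ab) })

  tokenLaplacian-*ᵥ : (f : Vector (KSubset n k)) (A : KSubset n k) →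
    (laplacian (tokenGraph G k) *ᵥ f) A ≈
    ∑[ a < n ] ∑[ b < n ] ([ does (movable? G (proj₁ A) a b) ] * (f A - f (swap a b A)))
  tokenLaplacian-*ᵥ {k} f A = begin
    (laplacian (tokenGraph G k) *ᵥ f) A
      ≈⟨ laplacian-*ᵥ (tokenGraph G k) f A ⟩
    sumOver (λ C → adjacencyMatrix (tokenGraph G k) A C * (f A - f C))
      ≈⟨ sumOver-cong expand ⟩
    sumOver (λ C → ∑[ a < n ] ∑[ b < n ] (movable a b * (δ a b C * (f A - f C))))
      ≈⟨ sumOver-sum (λ C a → ∑[ b < n ] (movable a b * (δ a b C * (f A - f C)))) ⟩
    ∑[ a < n ] sumOver (λ C → ∑[ b < n ] (movable a b * (δ a b C * (f A - f C))))
      ≈⟨ sum-cong (λ a → sumOver-sum (λ C b → movable a b * (δ a b C * (f A - f C)))) ⟩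
    ∑[ a < n ] ∑[ b < n ] sumOver (λ C → movable a b * (δ a b C * (f A - f C)))
      ≈⟨ sum²-cong (λ a b → sumOver-*ˡ (movable a b) (λ C → δ a b C * (f A - f C))) ⟨
    ∑[ a < n ] ∑[ b < n ] (movable a b * sumOver (λ C → δ a b C * (f A - f C)))
      ≈⟨ sum²-cong (λ a b → *-congˡ (sumOver-δ (λ C → f A - f C) (swap a b A))) ⟩
    ∑[ a < n ] ∑[ b < n ] (movable a b * (f A - f (swap a b A))) ∎
    where
    movable : Fin n → Fin n → Carrier
    movable a b = [ does (movable? G (proj₁ A) a b) ]
    δ : Fin n → Fin n → KSubset n k → Carrier
    δ a b C = [ does (swap a b A ≟ C) ]
    expand : ∀ C → adjacencyMatrix (tokenGraph G k) A C * (f A - f C) ≈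
                   ∑[ a < n ] ∑[ b < n ] (movable a b * (δ a b C * (f A - f C)))
    expand C = begin
      adjacencyMatrix (tokenGraph G k) A C * (f A - f C)
        ≈⟨ *-congʳ (tokenAdjacency-sum A C) ⟩
      ∑[ a < n ] ∑[ b < n ] (movable a b * δ a b C) * (f A - f C)
        ≈⟨ *-distribʳ-sum (f A - f C) (λ a → ∑[ b < n ] (movable a b * δ a b C)) ⟩
      ∑[ a < n ] (∑[ b < n ] (movable a b * δ a b C) * (f A - f C))
        ≈⟨ sum-cong (λ a → *-distribʳ-sum (f A - f C) (λ b → movable a b * δ a b C)) ⟩
      ∑[ a < n ] ∑[ b < n ] (movable a b * δ a b C * (f A - f C))
        ≈⟨ sum²-cong (λ a b → *-assoc (movable a b) (δ a b C) (f A - f C)) ⟩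
      ∑[ a < n ] ∑[ b < n ] (movable a b * (δ a b C * (f A - f C))) ∎

  does-∈? : ∀ a (A : Subset n) → does (a ∈? A) ≡ lookup A a
  does-∈? a A with a ∈? A
  ... | yes a∈A = ≡.sym ([]=⇒lookup a∈A)
  ... | no  a∉A = ≡.sym (∉⇒lookup a∉A)

  -- `p` and `q` record whether the endpoints lie in `A`, `r` whether they form an edge. If exactly
  -- one endpoint lies in `A`, exactly one orientation of an edge is a move; otherwise `x` is zero.
  orient : ∀ p q r {x} → (p ≡ q → x ≈ 0#) → [ r ] * x ≈ [ p ∧ not q ∧ r ] * x + [ q ∧ not p ∧ r ] * x
  orient true  true  r {x} x≈0 =
    trans (*-congˡ (x≈0 ≡.refl)) (trans (zeroʳ [ r ]) (sym (zero+zero (zeroˡ x) (zeroˡ x))))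
  orient true  false r {x} _   = sym (trans (+-congˡ (zeroˡ x)) (+-identityʳ ([ r ] * x)))
  orient false true  r {x} _   = sym (trans (+-congʳ (zeroˡ x)) (+-identityˡ ([ r ] * x)))
  orient false false r {x} x≈0 =
    trans (*-congˡ (x≈0 ≡.refl)) (trans (zeroʳ [ r ]) (sym (zero+zero (zeroˡ x) (zeroˡ x))))

  -- The factor 2 arises because each edge of G is met in both orientations.
  tokenLaplacian-double : (f : Vector (KSubset n k)) (A : KSubset n k) →
    (laplacian (tokenGraph G k) *ᵥ f) A + (laplacian (tokenGraph G k) *ᵥ f) A ≈
    ∑[ a < n ] ∑[ b < n ] (adjacencyMatrix G a b * (f A - f (swap a b A)))
  tokenLaplacian-double {k} f A = begin
    L + L
      ≈⟨ +-cong (tokenLaplacian-*ᵥ f A) (tokenLaplacian-*ᵥ f A) ⟩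
    -- Exchanging the sums in the second copy reverses the ordered pairs, so that `t a b` meets
    -- `t b a`.
    ∑[ a < n ] ∑[ b < n ] t a b + ∑[ a < n ] ∑[ b < n ] t a b        ≈⟨ +-congˡ (∑-comm t) ⟩
    ∑[ a < n ] ∑[ b < n ] t a b + ∑[ a < n ] ∑[ b < n ] t b a        ≈⟨ sum²-+ t (λ a b → t b a) ⟨
    ∑[ a < n ] ∑[ b < n ] (t a b + t b a)                            ≈⟨ sum²-cong pointwise ⟨
    ∑[ a < n ] ∑[ b < n ] (adjacencyMatrix G a b * g a b)            ∎
    where
    L = (laplacian (tokenGraph G k) *ᵥ f) A
    g : Fin n → Fin n → Carrier
    g a b = f A - f (swap a b A)
    t : Fin n → Fin n → Carrier
    t a b = [ does (movable? G (proj₁ A) a b) ] * g a b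

    g≈0 : ∀ a b → does (a ∈? proj₁ A) ≡ does (b ∈? proj₁ A) → g a b ≈ 0#
    g≈0 a b eq = trans
      (+-congˡ (-‿cong (reflexive (≡.cong f (swap-fix a b A
        (≡.trans (≡.sym (does-∈? a (proj₁ A))) (≡.trans eq (does-∈? b (proj₁ A)))))))))
      (-‿inverseʳ (f A))

    pointwise : ∀ a b → adjacencyMatrix G a b * g a b ≈ t a b + t b a
    pointwise a b = trans
      (orient (does (a ∈? proj₁ A)) (does (b ∈? proj₁ A)) (does (adjacent? G a b)) (g≈0 a b))
      (+-congˡ (*-cong
        (reflexive (≡.cong (λ r → [ does (b ∈? proj₁ A) ∧ not (does (a ∈? proj₁ A)) ∧ r ])
          (does-≡ (map′ (symmetric G) (symmetric G) (adjacent? G a b)) (adjacent? G b a))))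
        (+-congˡ (-‿cong (reflexive (≡.cong f (swap-comm a b A)))))))

  -- Equivariant matrices intertwine the token Laplacians

  Equivariant : Matrix (KSubset n k) (KSubset n h) → Set ℓ₁
  Equivariant M = ∀ a b A X → M (swap a b A) (swap a b X) ≈ M A X

  *ᵥ-swap : (M : Matrix (KSubset n k) (KSubset n h)) → Equivariant M → ∀ f a b A →
            (M *ᵥ f) (swap a b A) ≈ (M *ᵥ (f ∘ swap a b)) A
  *ᵥ-swap M equivariant f a b A = begin
    (M *ᵥ f) (swap a b A)
      -- `flip (transposition a b)` is `transposition b a`, so `swap b a` serves as the two-sided
      -- inverse.
      ≈⟨ sumOver-reindex (swap a b) (swap b a)
           (permuteK-flip (transposition b a)) (permuteK-flip (transposition a b))
           (λ X → M (swap a b A) X * f X) ⟨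
    sumOver (λ X → M (swap a b A) (swap a b X) * f (swap a b X))
      ≈⟨ sumOver-cong (λ X → *-congʳ {f (swap a b X)} (equivariant a b A X)) ⟩
    (M *ᵥ (f ∘ swap a b)) A ∎

  -- Doubled, both Laplacians are the same combination of operators I - τ, with coefficients
  -- independent of the subset and of its size. `M` commutes with each τ and so with the
  -- combination; the factor 2 is then cancelled.
  tokenLaplacian-intertwine : (M : Matrix (KSubset n k) (KSubset n h)) → Equivariant M → ∀ f →
    laplacian (tokenGraph G k) *ᵥ (M *ᵥ f) ≋ M *ᵥ (laplacian (tokenGraph G h) *ᵥ f)
  tokenLaplacian-intertwine {k} {h} M equivariant f A = double-injective (begin
    (Lₖ *ᵥ (M *ᵥ f)) A + (Lₖ *ᵥ (M *ᵥ f)) A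
      ≈⟨ tokenLaplacian-double (M *ᵥ f) A ⟩
    ∑[ a < n ] ∑[ b < n ] (adjacencyMatrix G a b * ((M *ᵥ f) A - (M *ᵥ f) (swap a b A)))
      ≈⟨ sum²-cong pointwise ⟩
    ∑[ a < n ] ∑[ b < n ] (M *ᵥ e a b) A
      ≈⟨ sum-cong (λ a → *ᵥ-sum M (e a) A) ⟨
    ∑[ a < n ] (M *ᵥ (λ X → ∑[ b < n ] e a b X)) A
      ≈⟨ *ᵥ-sum M (λ a X → ∑[ b < n ] e a b X) A ⟨
    (M *ᵥ (λ X → ∑[ a < n ] ∑[ b < n ] e a b X)) A
      ≈⟨ *ᵥ-cong M (tokenLaplacian-double f) A ⟨
    (M *ᵥ (λ X → (Lₕ *ᵥ f) X + (Lₕ *ᵥ f) X)) A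
      ≈⟨ *ᵥ-+ M (Lₕ *ᵥ f) (Lₕ *ᵥ f) A ⟩
    (M *ᵥ (Lₕ *ᵥ f)) A + (M *ᵥ (Lₕ *ᵥ f)) A ∎)
    where
    Lₖ = laplacian (tokenGraph G k)
    Lₕ = laplacian (tokenGraph G h)
    e : Fin n → Fin n → Vector (KSubset n h)
    e a b X = adjacencyMatrix G a b * (f X - f (swap a b X))
    pointwise : ∀ a b → adjacencyMatrix G a b * ((M *ᵥ f) A - (M *ᵥ f) (swap a b A)) ≈ (M *ᵥ e a b) A
    pointwise a b = begin
      adjacencyMatrix G a b * ((M *ᵥ f) A - (M *ᵥ f) (swap a b A))
        ≈⟨ *-congˡ (+-congˡ (-‿cong (*ᵥ-swap M equivariant f a b A))) ⟩
      adjacencyMatrix G a b * ((M *ᵥ f) A - (M *ᵥ (f ∘ swap a b)) A)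
        ≈⟨ *-congˡ (*ᵥ-sub M f (f ∘ swap a b) A) ⟨
      adjacencyMatrix G a b * (M *ᵥ (λ X → f X - f (swap a b X))) A
        ≈⟨ *ᵥ-scale M (adjacencyMatrix G a b) (λ X → f X - f (swap a b X)) A ⟨
      (M *ᵥ e a b) A ∎

  binomial-equivariant : Equivariant {k} {h} (binomialMatrix n k h)
  binomial-equivariant a b (A , _) (X , _) = reflexive (≡.cong [_] (does-≡
    (map′ {A = permute π X ⊆ permute π A} {B = X ⊆ A}
      (λ πX⊆πA → ⊆-permute⁻ π {X} {A} πX⊆πA) (λ X⊆A → ⊆-permute⁺ π {X} {A} X⊆A)
      (permute π X ⊆? permute π A))
    (X ⊆? A)))
    where π = transposition a b

open import Data.Nat using (_*_)

corollary4p5 : ∀ {c ℓ₁ ℓ₂ ℓ₃} (ℝ : RealNumbers c ℓ₁ ℓ₂ ℓ₃) →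
    let open LinearAlgebra ℝ in
    ∀ (n : ℕ) (G : SimpleGraph (Fin n)) (h k : ℕ) → 1 ≤ h → h ≤ k → 2 * k ≤ n →
    let B  = binomialMatrix n k h
        Lₕ = laplacian (tokenGraph G h)
        Lₖ = laplacian (tokenGraph G k)
    in
    -- (i)
    ( (∀ μ v → IsEigenvector Lₕ μ v → IsEigenvector Lₖ μ (B *ᵥ v))
    × (∀ r (v : Fin r → Vector (KSubset n h)) →
         (∀ i → ∃[ μ ] IsEigenvector Lₕ μ (v i)) →
         LinearlyIndependent v → LinearlyIndependent (λ i → B *ᵥ v i))
    × SpectrumContained Lₕ Lₖ )
    ×
    -- (ii)
    ( (∀ μ w → IsEigenvector Lₖ μ w → ¬ (B ᵀ *ᵥ w ≋ 0ᵥ) →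
         IsEigenvector Lₕ μ (B ᵀ *ᵥ w))
    × (∀ μ m → IsEigenvalue Lₕ μ → HasMultiplicity Lₕ μ m →
         ∃ λ (w : Fin m → Vector (KSubset n k)) →
           (∀ i → IsEigenvector Lₖ μ (w i)) × LinearlyIndependent (λ i → B ᵀ *ᵥ w i)) )
corollary4p5 ℝ n G h k _ h≤k 2k≤n =
  ( image
  , (λ r v _ independent → independent-image B injective v independent)
  , spectrumContained Lₖ Lₕ B up injective )
  ,
  ( (λ μ w → eigenvector-image Lₕ Lₖ (B ᵀ) down)
  , (λ μ m _ E → let open HasMultiplicity E in
      (λ i → B *ᵥ basis i) ,
      (λ i → image μ (basis i) (independent⇒nonzero basis independent i , eigen i)) ,
      Gram-independent B injective basis independent) )
  where
  open RealLinearAlgebra ℝ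
  open TokenGraph ℝ G
  B  = binomialMatrix n k h
  Lₕ = laplacian (tokenGraph G h)
  Lₖ = laplacian (tokenGraph G k)
  up : ∀ v → Lₖ *ᵥ (B *ᵥ v) ≋ B *ᵥ (Lₕ *ᵥ v)
  up = tokenLaplacian-intertwine B binomial-equivariant
  -- Equivariance treats rows and columns alike, so the same lemma serves the transpose with the two
  -- sizes exchanged.
  down : ∀ w → Lₕ *ᵥ (B ᵀ *ᵥ w) ≋ B ᵀ *ᵥ (Lₖ *ᵥ w)
  down = tokenLaplacian-intertwine (B ᵀ) (λ a b X A → binomial-equivariant a b A X)
  injective : ∀ v → B *ᵥ v ≋ 0ᵥ → v ≋ 0ᵥ
  -- `2 * k` unfolds to `k + (k + 0)`, which bounds `h + k`.
  injective = binomialMatrix-injective h≤k (ℕ.≤-trans (ℕ.+-mono-≤ h≤k (ℕ.m≤m+n k 0)) 2k≤n)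
  image : ∀ μ v → IsEigenvector Lₕ μ v → IsEigenvector Lₖ μ (B *ᵥ v)
  image μ v eigen@(v≢0 , _) = eigenvector-image Lₖ Lₕ B up eigen (v≢0 ∘ injective v)
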